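{- Given $\mu,\alpha>0$ and $r\in\mathbb{N}$ with $r\geq 3$, the following holds for all sufficiently large $n$. There exists an $n$-vertex graph $G$ with $$\delta(G)\geq \frac{2-\varrho(K_r)}{3-2\varrho(K_r)}\,n-\mu n\quad\text{and}\quad \alpha(G)\leq \alpha n$$ such that $G$ has no $r$-th power of a Hamilton cycle.
   Context: Graphs are finite and simple; $\delta(G)$ is the minimum degree and $\alpha(G)$ the independence number of $G$ (the plain symbol $\alpha$ is a real constant). The $r$-th power of a graph $H$ is obtained from $H$ by joining every pair of vertices at distance at most $r$ in $H$; an $r$-th power of a Hamilton cycle in $G$ is a (not necessarily induced) spanning subgraph of $G$ that is the $r$-th power of a cycle on $|V(G)|$ vertices. For a graph $H$ and $m,n\in\mathbb{N}$ (or real $m$), the Ramsey--Turán number $\mathbf{RT}(n,H,m)$ is the maximum number of edges in an $n$-vertex $H$-free graph $G$ with $\alpha(G)\le m$. The Ramsey--Turán density of $K_r$ is $\varrho(K_r):=\lim_{\alpha\to 0}\lim_{n\to\infty}\mathbf{RT}(n,K_r,\alpha n)/\binom{n}{2}$. It is known (Erdős--Sós; Erdős--Hajnal--Sós--Szemerédi) that $\varrho(K_r)=1-\frac{2}{r-1}$ if $r$ is odd and $\varrho(K_r)=1-\frac{6}{3r-4}$ if $r$ is even. -}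

module Defs where

open import Data.Fin using (Fin; toℕ; _<?_)
open import Data.Fin.Properties using (any?; all?) renaming (_≟_ to _≟ᶠ_)
open import Data.Fin.Subset using (Subset; _∈_; ∣_∣)
open import Data.Fin.Subset.Properties using (_∈?_; anySubset?)
open import Data.Integer using (+_)
open import Data.List using (length; filter; map; allFin; cartesianProduct; upTo)
open import Data.List.Extrema.Nat using (min; max)
open import Data.Nat as ℕ using (ℕ; zero; suc)
open import Data.Nat.Combinatorics using (_C_)
import Data.Nat.Properties as ℕ
open import Data.Product using (∃-syntax; _×_; _,_; proj₁; proj₂)
open import Data.Rational using (ℚ; _/_; 0ℚ; 1ℚ; ½; _+_; _*_; _-_; _÷_; 1/_; _≤_; _<_; NonZero; Positive; positive; nonNegative; ≢-nonZero)
  renaming (∣_∣ to ∣_∣ᵃ)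
import Data.Rational.Properties as ℚ
open import Data.Rational.Solver using (module +-*-Solver)
open import Data.Sum using (_⊎_; inj₁; inj₂; swap)
open import Function using (Injective)
open import Relation.Binary using (Rel; Decidable; Symmetric; Irreflexive)
open import Relation.Binary.PropositionalEquality
open import Relation.Nullary using (¬_; Dec; yes; no)
open import Relation.Nullary.Decidable using (_×-dec_; _⊎-dec_; _→-dec_; ¬?)
open import Level using (0ℓ)

fromℕ : ℕ → ℚ
fromℕ n = + n / 1

-- Division made total by p ÷₀ 0 = 0. It is only used where the divisor is
-- in fact positive.
_÷₀_ : ℚ → ℚ → ℚ
p ÷₀ q with q ℚ.≟ 0ℚ
... | yes _   = 0ℚ
... | no q≢0 = (p ÷ q) ⦃ ≢-nonZero q≢0 ⦄

infixl 7 _÷₀_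

------------------------------------------------------------------------
-- Real numbers: Cauchy sequences of rationals. Equality of reals is not
-- needed; the order relations below are those of the limits.

record ℝ : Set where
  field
    seq    : ℕ → ℚ
    cauchy : ∀ ε → 0ℚ < ε → ∃[ N ] ∀ i j → N ℕ.≤ i → N ℕ.≤ j →
             ∣ seq i - seq j ∣ᵃ ≤ ε

open ℝ public

infix 4 _≤ᴿ_ _<ᴿ_

_≤ᴿ_ : Rel ℝ 0ℓ
x ≤ᴿ y = ∀ ε → 0ℚ < ε → ∃[ N ] ∀ i → N ℕ.≤ i → seq x i ≤ seq y i + ε

_<ᴿ_ : Rel ℝ 0ℓ
x <ᴿ y = ∃[ ε ] 0ℚ < ε × ∃[ N ] ∀ i → N ℕ.≤ i → seq x i + ε ≤ seq y i

private
  half-pos : ∀ {ε} → 0ℚ < ε → 0ℚ < ½ * ε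
  half-pos {ε} 0<ε = subst (_< ½ * ε) (ℚ.*-zeroʳ ½) (ℚ.*-monoʳ-<-pos ½ 0<ε)

  halves : ∀ ε → ½ * ε + ½ * ε ≡ ε
  halves ε = trans (sym (ℚ.*-distribʳ-+ ε ½ ½)) (ℚ.*-identityˡ ε)

fromℚ : ℚ → ℝ
fromℚ q .seq    _ = q
fromℚ q .cauchy ε 0<ε = 0 , λ _ _ _ _ →
  ℚ.≤-trans (ℚ.≤-reflexive (cong ∣_∣ᵃ (ℚ.+-inverseʳ q))) (ℚ.<⇒≤ 0<ε)

infixl 6 _-ᴿ_
infixr 7 _·_

_-ᴿ_ : ℝ → ℝ → ℝ
(x -ᴿ y) .seq i = seq x i - seq y i
(x -ᴿ y) .cauchy ε 0<ε
  with M , hx ← cauchy x (½ * ε) (half-pos 0<ε)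
     | N , hy ← cauchy y (½ * ε) (half-pos 0<ε)
  = M ℕ.⊔ N , λ i j i≥ j≥ → begin
      ∣ (seq x i - seq y i) - (seq x j - seq y j) ∣ᵃ
        ≡⟨ cong ∣_∣ᵃ (rearrange (seq x i) (seq y i) (seq x j) (seq y j)) ⟩
      ∣ (seq x i - seq x j) - (seq y i - seq y j) ∣ᵃ
        ≤⟨ ℚ.∣p-q∣≤∣p∣+∣q∣ (seq x i - seq x j) (seq y i - seq y j) ⟩
      ∣ seq x i - seq x j ∣ᵃ + ∣ seq y i - seq y j ∣ᵃ
        ≤⟨ ℚ.+-mono-≤
             (hx i j (ℕ.m⊔n≤o⇒m≤o M N i≥) (ℕ.m⊔n≤o⇒m≤o M N j≥))
             (hy i j (ℕ.m⊔n≤o⇒n≤o M N i≥) (ℕ.m⊔n≤o⇒n≤o M N j≥)) ⟩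
      ½ * ε + ½ * ε
        ≡⟨ halves ε ⟩
      ε ∎
  where
  open ℚ.≤-Reasoning
  open +-*-Solver
  rearrange : ∀ a b c d → (a - b) - (c - d) ≡ (a - c) - (b - d)
  rearrange = solve 4 (λ a b c d →
    (a :- b) :- (c :- d) := (a :- c) :- (b :- d)) refl

_·_ : ℚ → ℝ → ℝ
(q · x) .seq i = q * seq x i
(q · x) .cauchy ε 0<ε = proj₁ step , λ i j i≥ j≥ → begin
    ∣ q * seq x i - q * seq x j ∣ᵃ
      ≡⟨ cong ∣_∣ᵃ (factor q (seq x i) (seq x j)) ⟩
    ∣ q * (seq x i - seq x j) ∣ᵃ
      ≡⟨ ℚ.∣p*q∣≡∣p∣*∣q∣ q _ ⟩
    ∣ q ∣ᵃ * ∣ seq x i - seq x j ∣ᵃ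
      ≤⟨ ℚ.*-monoʳ-≤-nonNeg ∣ seq x i - seq x j ∣ᵃ
           ⦃ nonNegative (ℚ.0≤∣p∣ (seq x i - seq x j)) ⦄ (ℚ.<⇒≤ ∣q∣<b) ⟩
    b * ∣ seq x i - seq x j ∣ᵃ
      ≤⟨ ℚ.*-monoˡ-≤-nonNeg b ⦃ ℚ.pos⇒nonNeg b ⦄ (proj₂ step i j i≥ j≥) ⟩
    b * (ε * 1/ b)
      ≡⟨ cancel b ε (1/ b) ⟩
    ε * (b * 1/ b)
      ≡⟨ cong (ε *_) (ℚ.*-inverseʳ b) ⟩
    ε * 1ℚ
      ≡⟨ ℚ.*-identityʳ ε ⟩
    ε ∎
  where
  open ℚ.≤-Reasoning
  open +-*-Solver

  b : ℚ
  b = ∣ q ∣ᵃ + 1ℚ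

  ∣q∣<b : ∣ q ∣ᵃ < b
  ∣q∣<b = subst (_< b) (ℚ.+-identityʳ ∣ q ∣ᵃ)
    (ℚ.+-monoʳ-< ∣ q ∣ᵃ (ℚ.positive⁻¹ 1ℚ))

  instance
    b-pos : Positive b
    b-pos = positive (ℚ.≤-<-trans (ℚ.0≤∣p∣ q) ∣q∣<b)

    b-nonZero : NonZero b
    b-nonZero = ℚ.pos⇒nonZero b

  0<ε/b : 0ℚ < ε * 1/ b
  0<ε/b = subst (_< ε * 1/ b) (ℚ.*-zeroˡ (1/ b))
    (ℚ.*-monoˡ-<-pos (1/ b) ⦃ ℚ.1/pos⇒pos b ⦄ 0<ε)

  step = cauchy x (ε * 1/ b) 0<ε/b

  factor : ∀ a c d → a * c - a * d ≡ a * (c - d)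
  factor = solve 3 (λ a c d → a :* c :- a :* d := a :* (c :- d)) refl

  cancel : ∀ a c d → a * (c * d) ≡ c * (a * d)
  cancel = solve 3 (λ a c d → a :* (c :* d) := c :* (a :* d)) refl

-- |x - y| ≤ ε
Within : ℚ → Rel ℝ 0ℓ
Within ε x y = (x -ᴿ y ≤ᴿ fromℚ ε) × (y -ᴿ x ≤ᴿ fromℚ ε)

------------------------------------------------------------------------
-- Finite simple graphs

record Graph (n : ℕ) : Set₁ where
  field
    _~_       : Rel (Fin n) 0ℓ
    _~?_      : Decidable _~_
    ~-sym     : Symmetric _~_
    ~-irrefl  : Irreflexive _≡_ _~_

module _ {n : ℕ} (G : Graph n) where
  open Graph G

  degree : Fin n → ℕ
  degree v = length (filter (v ~?_) (allFin n))

  -- The default value n exceeds every degree, so it matters only for n = 0.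
  minDegree : ℕ
  minDegree = min n (map degree (allFin n))

  edgeCount : ℕ
  edgeCount = length (filter (λ (u , v) → (u <? v) ×-dec (u ~? v))
                             (cartesianProduct (allFin n) (allFin n)))

  Independent : Subset n → Set
  Independent S = ∀ u v → u ∈ S → v ∈ S → ¬ (u ~ v)

  independent? : ∀ S → Dec (Independent S)
  independent? S = all? λ u → all? λ v →
    (u ∈? S) →-dec ((v ∈? S) →-dec ¬? (u ~? v))

  independenceNumber : ℕ
  independenceNumber = max 0
    (filter (λ k → anySubset? (λ S → independent? S ×-dec (∣ S ∣ ℕ.≟ k)))
            (upTo (suc n)))

-- H is isomorphic to a (not necessarily induced) subgraph of G.
_⊑_ : ∀ {m n} → Graph m → Graph n → Set
_⊑_ {m} {n} H G = ∃[ f ] Injective {A = Fin m} {B = Fin n} _≡_ _≡_ f ×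
                  (∀ u v → Graph._~_ H u v → Graph._~_ G (f u) (f v))

_Free : ∀ {m n} → Graph m → Graph n → Set
(H Free) G = ¬ (H ⊑ G)

K : ∀ r → Graph r
K r = record
  { _~_      = _≢_
  ; _~?_     = λ u v → ¬? (u ≟ᶠ v)
  ; ~-sym    = ≢-sym
  ; ~-irrefl = λ u≡v u≢v → u≢v u≡v
  }

Next : ∀ {n} → Rel (Fin n) 0ℓ
Next {n} i j = (toℕ j ≡ suc (toℕ i)) ⊎ (suc (toℕ i) ≡ n × toℕ j ≡ 0)

next? : ∀ {n} → Decidable (Next {n})
next? {n} i j = (toℕ j ℕ.≟ suc (toℕ i)) ⊎-dec
                ((suc (toℕ i) ℕ.≟ n) ×-dec (toℕ j ℕ.≟ 0))

-- The cycle on n vertices; the usual graph for n ≥ 3.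
Cycle : ∀ n → Graph n
Cycle n = record
  { _~_      = λ i j → i ≢ j × (Next i j ⊎ Next j i)
  ; _~?_     = λ i j → ¬? (i ≟ᶠ j) ×-dec (next? i j ⊎-dec next? j i)
  ; ~-sym    = λ (i≢j , e) → ≢-sym i≢j , swap e
  ; ~-irrefl = λ i≡j (i≢j , _) → i≢j i≡j
  }

module _ {n : ℕ} (H : Graph n) where
  open Graph H

  DistanceAtMost : ℕ → Rel (Fin n) 0ℓ
  DistanceAtMost zero    u v = u ≡ v
  DistanceAtMost (suc k) u v =
    DistanceAtMost k u v ⊎ (∃[ w ] DistanceAtMost k u w × w ~ v)

  distanceAtMost? : ∀ k → Decidable (DistanceAtMost k)
  distanceAtMost? zero    u v = u ≟ᶠ v
  distanceAtMost? (suc k) u v =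
    distanceAtMost? k u v ⊎-dec
    any? (λ w → distanceAtMost? k u w ×-dec (w ~? v))

  private
    cons : ∀ k {u v w} → u ~ v → DistanceAtMost k v w → DistanceAtMost (suc k) u w
    cons zero    e refl               = inj₂ (_ , refl , e)
    cons (suc k) e (inj₁ p)           = inj₁ (cons k e p)
    cons (suc k) e (inj₂ (w , p , f)) = inj₂ (w , cons k e p , f)

    reverse : ∀ k {u v} → DistanceAtMost k u v → DistanceAtMost k v u
    reverse zero    p                  = sym p
    reverse (suc k) (inj₁ p)           = inj₁ (reverse k p)
    reverse (suc k) (inj₂ (w , p , e)) = cons k (~-sym e) (reverse k p)

  power : ℕ → Graph n
  power r = record
    { _~_      = λ u v → u ≢ v × DistanceAtMost r u v
    ; _~?_     = λ u v → ¬? (u ≟ᶠ v) ×-dec distanceAtMost? r u v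
    ; ~-sym    = λ (u≢v , p) → ≢-sym u≢v , reverse r p
    ; ~-irrefl = λ u≡v (u≢v , _) → u≢v u≡v
    }

-- A copy on the same number of vertices is automatically spanning.
HasHamiltonCyclePower : ∀ {n} → ℕ → Graph n → Set
HasHamiltonCyclePower {n} r G = power (Cycle n) r ⊑ G

------------------------------------------------------------------------
-- Ramsey–Turán numbers and densities

RTAdmissible : ∀ n {h} → Graph h → ℝ → Graph n → Set
RTAdmissible n H m G =
  (H Free) G × fromℚ (fromℕ (independenceNumber G)) ≤ᴿ m

-- RT(n,H,m) = k. The maximum is given as a relation because it is undefined
-- when no graph is admissible.
IsRT : ∀ n {h} → Graph h → ℝ → ℕ → Set₁
IsRT n H m k =
  (∃[ G ] RTAdmissible n H m G × edgeCount G ≡ k) ×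
  (∀ G → RTAdmissible n H m G → edgeCount G ℕ.≤ k)

-- lim_{n→∞} RT(n,H,αn) / (n choose 2) = ℓ, where the Ramsey–Turán numbers
-- have to be defined for all large n.
IsRTLimit : ∀ {h} → Graph h → ℝ → ℝ → Set₁
IsRTLimit H α ℓ =
  ∀ ε → 0ℚ < ε → ∃[ N ] ∀ n → N ℕ.≤ n →
    ∃[ k ] IsRT n H (fromℕ n · α) k ×
           Within ε (fromℚ (fromℕ k ÷₀ fromℕ (n C 2))) ℓ

-- ϱ(H) = ρ, where ϱ(H) is the limit as α → 0 of the limits above. The inner
-- limit is only required to exist for all sufficiently small α > 0. A rational
-- ρ suffices for complete graphs, since ϱ(K_r) is 1 - 2/(r-1) for odd r and
-- 1 - 6/(3r-4) for even r.
IsRTDensity : ∀ {h} → Graph h → ℚ → Set₁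
IsRTDensity H ρ =
  ∀ ε → 0ℚ < ε → ∃[ α₀ ] 0ℚ < α₀ × (∀ α → fromℚ 0ℚ <ᴿ α → α <ᴿ fromℚ α₀ →
    ∃[ ℓ ] IsRTLimit H α ℓ × Within ε ℓ (fromℚ ρ))

-- (2 - ρ) / (3 - 2ρ). Densities are at most 1, so the divisor is then at least 1.
degreeRatio : ℚ → ℚ
degreeRatio ρ = (fromℕ 2 - ρ) ÷₀ (fromℕ 3 - fromℕ 2 * ρ)

-- Let σ = 3 − 2ρ. Take a K_r-free graph A on about n/σ vertices with minimum degree about
-- ρ|A| and small independence number, and join it completely to the disjoint union of two
-- cliques on about (n − |A|)/2 vertices each. Every degree is then about (2 − ρ)n/σ. On an
-- r-th power of a Hamilton cycle, the vertices strictly between consecutive visits to the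
-- two cliques all lie in A, and there are at least r of them because vertices at distance
-- at most r are adjacent; so A would contain a K_r.
--
-- The density hypothesis yields K_r-free graphs with small independence number and edge
-- density about ρ. Deleting vertices of low degree turns this into a minimum degree
-- condition while keeping a fixed proportion of the vertices, and blowing up vertices to
-- independent sets of equal size gives A at every large order without changing the ratios.
-- As minimum degrees are below the order, the same graphs show that ρ ≤ 1.

module Submission where

open import Defs
import Algebra.Properties.CommutativeMonoid.Sum as Sum
import Algebra.Solver.Ring
open import Algebra.Solver.Ring.AlmostCommutativeRing 
  using (AlmostCommutativeRing; fromCommutativeRing; _-Raw-AlmostCommutative⟶_; Induced-equivalence)
open import Data.Bool using (Bool; true; false; T)
open import Data.Bool.Properties using (T?; T-≡) renaming (_≟_ to _≟ᵇ_)
open import Data.Fin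
  using (Fin; zero; suc; toℕ; fromℕ<; inject₁; splitAt; join; _↑ˡ_; _↑ʳ_; combine; quotient; punchIn; punchOut; _<?_)
  renaming (_<_ to _<ᶠ_)
open import Data.Fin.Properties
  using (toℕ-injective; toℕ-inject₁; toℕ-fromℕ<; toℕ<n; splitAt-↑ˡ; splitAt-↑ʳ; splitAt⁻¹-↑ˡ; join-splitAt;
         remQuot-combine; punchIn-punchOut; punchInᵢ≢i; punchOut-injective; injective⇒≤; any?; all?; ¬∀⟶∃¬; <-cmp)
  renaming (_≟_ to _≟ᶠ_)
open import Data.Fin.Subset using (Subset; ∣_∣; _∈_)
open import Data.Fin.Subset.Properties using (anySubset?)
open import Data.Integer as ℤ using (ℤ)
import Data.Integer.Properties as ℤ
open import Data.List as List using (List; []; _∷_; _++_; length; filter; allFin; cartesianProduct; tabulate; upTo)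
open import Data.List.Extrema.Nat using (argmin-all; max≤v⁺; xs≤max)
open import Data.List.Membership.Propositional.Properties using (∈-filter⁺; ∈-upTo⁺)
open import Data.List.Properties using (length-++; filter-++)
import Data.List.Relation.Unary.All as All
open import Data.List.Relation.Unary.All.Properties using (map⁺; tabulate⁺; all-filter)
open import Data.Maybe as Maybe using (Maybe; just; nothing)
open import Data.Maybe.Properties using (≡-dec)
open import Data.Nat as ℕ using (ℕ; zero; suc; ⌊_/2⌋; ⌈_/2⌉; s≤s; z≤n)
open import Data.Nat.Combinatorics using (_C_; nC1≡n; nCk+nC[k+1]≡[n+1]C[k+1])
import Data.Nat.Properties as ℕ
import Data.Nat.Tactic.RingSolver as ℕ-solver
open import Data.Product using (_×_; _,_; proj₁; proj₂; ∃-syntax; Σ-syntax)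
open import Data.Sum using (_⊎_; inj₁; inj₂; [_,_]; [_,_]′)
open import Data.Vec as Vec using (Vec; []; _∷_; lookup)
open import Data.Vec.Functional using (insertAt)
open import Data.Vec.Functional.Properties using (insertAt-lookup; insertAt-punchIn)
open import Data.Vec.Properties using (lookup∘tabulate; []=⇒lookup; lookup⇒[]=)
open import Function using (_∘_; id; const; Equivalence; Injective)
open import Level using (0ℓ)
open import Relation.Binary.Definitions using (WeaklyDecidable; Tri; tri<; tri≈; tri>)
open import Relation.Binary.PropositionalEquality
open import Relation.Nullary using (¬_; Dec; yes; no; does; contradiction)
open import Relation.Nullary.Decidable using (_×-dec_; ¬?; dec-true; dec-false; dec⇒maybe)
open import Relation.Unary using (Pred; Decidable)

private variable
  m n : ℕ

-- Graphs, degrees and independent sets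

module _ where
  open Sum ℕ.+-0-commutativeMonoid using (sum; sum-cong-≗; sum-remove; ∑-distrib-+; ∑-comm)
  open import Data.Nat using (_+_; _*_; _≤_; _<_)
  open import Data.Nat.Properties hiding (_<?_; <-cmp)

  ind : Bool → ℕ
  ind true  = 1
  ind false = 0

  ind≤1 : ∀ b → ind b ≤ 1
  ind≤1 true  = ≤-refl
  ind≤1 false = z≤n

  sum-mono : {f g : Fin n → ℕ} → (∀ i → f i ≤ g i) → sum f ≤ sum g
  sum-mono {zero}  h = z≤n
  sum-mono {suc n} h = +-mono-≤ (h zero) (sum-mono (h ∘ suc))

  sum-const : ∀ n c → sum {n} (λ _ → c) ≡ n * c
  sum-const zero    c = refl
  sum-const (suc n) c = cong (c +_) (sum-const n c)

  sum-ind≤ : (s : Fin n → Bool) → sum (ind ∘ s) ≤ n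
  sum-ind≤ {n} s = ≤-trans (sum-mono (ind≤1 ∘ s)) (≤-reflexive (trans (sum-const n 1) (*-identityʳ n)))

  sum-*ˡ : ∀ c (f : Fin n → ℕ) → sum (λ i → c * f i) ≡ c * sum f
  sum-*ˡ {zero}  c f = sym (*-zeroʳ c)
  sum-*ˡ {suc n} c f = trans (cong (c * f zero +_) (sum-*ˡ c (f ∘ suc))) (sym (*-distribˡ-+ c (f zero) _))

  sum-↑ : ∀ m (f : Fin (m + n) → ℕ) → sum f ≡ sum (f ∘ (_↑ˡ n)) + sum (f ∘ (m ↑ʳ_))
  sum-↑ zero    f = refl
  sum-↑ (suc m) f = trans (cong (f zero +_) (sum-↑ m (f ∘ suc))) (sym (+-assoc (f zero) _ _))

  sum-combine : ∀ m {n} (f : Fin (m * n) → ℕ) → sum f ≡ sum (λ i → sum (λ j → f (combine {m} i j)))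
  sum-combine zero        f = refl
  sum-combine (suc m) {n} f =
    trans (sum-↑ n f) (cong (sum (f ∘ (_↑ˡ (m * n))) +_) (sum-combine m (f ∘ (n ↑ʳ_))))

  length-filter-tabulate : {A : Set} {P : Pred A 0ℓ} (P? : Decidable P) (f : Fin n → A) →
    length (filter P? (tabulate f)) ≡ sum (λ i → ind (does (P? (f i))))
  length-filter-tabulate {zero}  P? f = refl
  length-filter-tabulate {suc n} P? f with does (P? (f zero))
  ... | true  = cong suc (length-filter-tabulate P? (f ∘ suc))
  ... | false = length-filter-tabulate P? (f ∘ suc)

  length-filter-map : {A B : Set} {P : Pred B 0ℓ} (P? : Decidable P) (f : A → B) (xs : List A) →
    length (filter P? (List.map f xs)) ≡ length (filter (P? ∘ f) xs)
  length-filter-map P? f []       = refl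
  length-filter-map P? f (x ∷ xs) with does (P? (f x))
  ... | true  = cong suc (length-filter-map P? f xs)
  ... | false = length-filter-map P? f xs

  length-filter-product : {A B : Set} {P : Pred (A × B) 0ℓ} (P? : Decidable P) (f : Fin m → A) (g : Fin n → B) →
    length (filter P? (cartesianProduct (tabulate f) (tabulate g))) ≡
    sum (λ i → sum (λ j → ind (does (P? (f i , g j)))))
  length-filter-product {zero}  P? f g = refl
  length-filter-product {suc m} P? f g = begin
    length (filter P? (row ++ rest))
      ≡⟨ cong length (filter-++ P? row rest) ⟩
    length (filter P? row ++ filter P? rest)
      ≡⟨ length-++ (filter P? row) ⟩
    length (filter P? row) + length (filter P? rest)
      ≡⟨ cong₂ _+_ (trans (length-filter-map P? _ (tabulate g)) (length-filter-tabulate (λ y → P? (f zero , y)) g))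
                   (length-filter-product P? (f ∘ suc) g) ⟩
    _ ∎
    where
    open ≡-Reasoning
    row  = List.map (f zero ,_) (tabulate g)
    rest = cartesianProduct (tabulate (f ∘ suc)) (tabulate g)

  ∣∣≡sum : (p : Subset n) → ∣ p ∣ ≡ sum (λ i → ind (lookup p i))
  ∣∣≡sum []          = refl
  ∣∣≡sum (true  ∷ p) = cong suc (∣∣≡sum p)
  ∣∣≡sum (false ∷ p) = ∣∣≡sum p

  -- If `y` is missed, punching it out turns `f` into an injection of `Fin (suc n)` into `Fin n`.
  injective⇒surjective : {f : Fin n → Fin n} → Injective _≡_ _≡_ f → ∀ y → ∃[ x ] f x ≡ y
  injective⇒surjective {suc n} {f} inj y with any? (λ x → f x ≟ᶠ y)
  ... | yes hit = hit
  ... | no miss = contradiction (injective⇒≤ {f = λ x → punchOut (y≢ x)} λ {x} {x′} eq →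
                    inj (punchOut-injective (y≢ x) (y≢ x′) eq)) 1+n≰n
    where
    y≢ : ∀ x → y ≢ f x
    y≢ x eq = miss (x , sym eq)

  ↑-elim : ∀ m {n} (P : Fin (m + n) → Set) → (∀ i → P (i ↑ˡ n)) → (∀ j → P (m ↑ʳ j)) → ∀ u → P u
  ↑-elim m {n} P l r u = subst P (join-splitAt m n u) ([_,_] {C = P ∘ join m n} l r (splitAt m u))

  module _ (G : Graph n) where
    open Graph G

    adj : Fin n → Fin n → ℕ
    adj u v = ind (does (u ~? v))

    deg : Fin n → ℕ
    deg u = sum (adj u)

    degreeSum : ℕ
    degreeSum = sum deg

    -- Any such `g` is injective by irreflexivity of adjacency. In this form the property passes
    -- along vertex maps that are not injective, such as the projection of a blow-up.
    CliqueFree : ℕ → Set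
    CliqueFree r = ∀ (g : Fin r → Fin n) → ¬ (∀ i j → i ≢ j → g i ~ g j)

    -- With vertex sets as Boolean functions, sizes are sums that split along decompositions of
    -- `Fin`, and restriction to a part is composition.
    IndependentMap : (Fin n → Bool) → Set
    IndependentMap s = ∀ u v → T (s u) → T (s v) → ¬ u ~ v

    IndependenceAtMost : ℕ → Set
    IndependenceAtMost B = ∀ s → IndependentMap s → sum (ind ∘ s) ≤ B

    degree≡deg : ∀ u → degree G u ≡ deg u
    degree≡deg u = length-filter-tabulate (u ~?_) id

    free⇒cliqueFree : ∀ {r} → (K r Free) G → CliqueFree r
    free⇒cliqueFree free g clique = free (g , inj , clique)
      where
      inj : Injective _≡_ _≡_ g
      inj {i} {j} eq with i ≟ᶠ j
      ... | yes i≡j = i≡j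
      ... | no  i≢j = contradiction (clique i j i≢j) (~-irrefl eq)

    independentOfSize? : ∀ k → Dec (∃[ S ] Independent G S × ∣ S ∣ ≡ k)
    independentOfSize? k = anySubset? λ S → independent? G S ×-dec (∣ S ∣ ℕ.≟ k)

    independenceNumber≤ : ∀ {B} → IndependenceAtMost B → independenceNumber G ≤ B
    independenceNumber≤ {B} h = max≤v⁺ z≤n (All.map bound (all-filter independentOfSize? (upTo (suc n))))
      where
      bound : ∀ {k} → (∃[ S ] Independent G S × ∣ S ∣ ≡ k) → k ≤ B
      bound (S , indep , refl) = subst (_≤ B) (sym (∣∣≡sum S)) (h (lookup S) λ u v su sv →
        indep u v (lookup⇒[]= u S (Equivalence.to T-≡ su)) (lookup⇒[]= v S (Equivalence.to T-≡ sv)))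

    independenceAtMost : IndependenceAtMost (independenceNumber G)
    independenceAtMost s indep =
      All.lookup (xs≤max 0 _) (∈-filter⁺ independentOfSize? (∈-upTo⁺ (s≤s (sum-ind≤ s))) (S , S-indep , trans (∣∣≡sum S)
        (sum-cong-≗ λ i → cong ind (lookup∘tabulate s i))))
      where
      S = Vec.tabulate s
      S-indep : Independent G S
      S-indep u v u∈ v∈ = indep u v (member u u∈) (member v v∈)
        where
        member : ∀ w → w ∈ S → T (s w)
        member w w∈ = Equivalence.from T-≡ (trans (sym (lookup∘tabulate s w)) ([]=⇒lookup w∈))

    adj-sym : ∀ u v → adj u v ≡ adj v u
    adj-sym u v with u ~? v | v ~? u
    ... | yes _ | yes _  = refl
    ... | no  _ | no  _  = refl
    ... | yes e | no  ¬e = contradiction (~-sym e) ¬e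
    ... | no ¬e | yes e  = contradiction (~-sym e) ¬e

    adj-irrefl : ∀ u → adj u u ≡ 0
    adj-irrefl u = cong ind (dec-false (u ~? u) (~-irrefl refl))

    deg≤n : ∀ u → deg u ≤ n
    deg≤n u = sum-ind≤ λ v → does (u ~? v)

    degreeSum≤n² : degreeSum ≤ n * n
    degreeSum≤n² = ≤-trans (sum-mono deg≤n) (≤-reflexive (sum-const n n))

    -- Swapping the summations turns the second copy of the edge count into a count of pairs with
    -- `v` below `u`. As `u` and `v` satisfy at most one of the two orders, each entry is at most
    -- `adj u v`.
    2*edgeCount≤degreeSum : edgeCount G + edgeCount G ≤ degreeSum
    2*edgeCount≤degreeSum = begin
      edgeCount G + edgeCount G
        ≡⟨ cong₂ _+_ edges≡ (trans edges≡ (∑-comm {n} {n} up)) ⟩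
      sum (λ u → sum (λ v → up u v)) + sum (λ u → sum (λ v → up v u))
        ≡⟨ ∑-distrib-+ {n} _ _ ⟨
      sum (λ u → sum (λ v → up u v) + sum (λ v → up v u))
        ≡⟨ sum-cong-≗ (λ u → sym (∑-distrib-+ (up u) (λ v → up v u))) ⟩
      sum (λ u → sum (λ v → up u v + up v u))
        ≤⟨ sum-mono (λ u → sum-mono (λ v → up+down≤ u v)) ⟩
      degreeSum ∎
      where
      open ≤-Reasoning
      up : Fin n → Fin n → ℕ
      up u v = ind (does ((u <? v) ×-dec (u ~? v)))
      edges≡ : edgeCount G ≡ sum (λ u → sum (λ v → up u v))
      edges≡ = length-filter-product (λ (u , v) → (u <? v) ×-dec (u ~? v)) id id
      up+down≤ : ∀ u v → up u v + up v u ≤ adj u v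
      up+down≤ u v = split (u <? v) (v <? u)
        where
        split : (p : Dec (u <ᶠ v)) (q : Dec (v <ᶠ u)) →
          ind (does (p ×-dec (u ~? v))) + ind (does (q ×-dec (v ~? u))) ≤ adj u v
        split (yes u<v) (yes v<u) = contradiction v<u (<⇒≯ u<v)
        split (yes _)   (no  _)   = ≤-reflexive (+-identityʳ _)
        split (no  _)   (yes _)   = ≤-reflexive (adj-sym v u)
        split (no  _)   (no  _)   = z≤n

  -- Pullbacks: vertex deletion and blow-ups

  pullback : (Fin m → Fin n) → Graph n → Graph m
  pullback f G = record
    { _~_      = λ u v → f u ~ f v
    ; _~?_     = λ u v → f u ~? f v
    ; ~-sym    = ~-sym
    ; ~-irrefl = λ u≡v → ~-irrefl (cong f u≡v)
    } where open Graph G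

  pullback-cliqueFree : ∀ {r} (f : Fin m → Fin n) (G : Graph n) →
    CliqueFree G r → CliqueFree (pullback f G) r
  pullback-cliqueFree f G free g = free (f ∘ g)

  delete : Fin (suc n) → Graph (suc n) → Graph n
  delete v = pullback (punchIn v)

  -- Extending a set by `false` at `v` keeps its size and its independence.
  delete-independence : ∀ {B} v (G : Graph (suc n)) →
    IndependenceAtMost G B → IndependenceAtMost (delete v G) B
  delete-independence {B = B} v G h s indep = subst (_≤ B) size (h s′ indep′)
    where
    open Graph G
    s′ = insertAt s v false
    size : sum (ind ∘ s′) ≡ sum (ind ∘ s)
    size = trans (sum-remove {i = v} (ind ∘ s′))
      (cong₂ _+_ (cong ind (insertAt-lookup s v false)) (sum-cong-≗ λ i → cong ind (insertAt-punchIn s v false i)))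
    indep′ : IndependentMap G s′
    indep′ x y sx sy with v ≟ᶠ x | v ≟ᶠ y
    ... | yes refl | _        = contradiction (subst T (insertAt-lookup s v false) sx) λ ()
    ... | no _     | yes refl = contradiction (subst T (insertAt-lookup s v false) sy) λ ()
    ... | no v≢x   | no v≢y   = subst₂ (λ a b → ¬ a ~ b) (punchIn-punchOut v≢x) (punchIn-punchOut v≢y)
        (indep _ _ (back v≢x sx) (back v≢y sy))
      where
      back : ∀ {z} (v≢z : v ≢ z) → T (s′ z) → T (s (punchOut v≢z))
      back v≢z sz = subst T (insertAt-punchIn s v false (punchOut v≢z))
        (subst (T ∘ s′) (sym (punchIn-punchOut v≢z)) sz)

  -- In the adjacency matrix `deg G v` is lost twice, as the row of `v` and, by symmetry, as its
  -- column; the diagonal entry is zero.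
  degreeSum-delete : ∀ v (G : Graph (suc n)) →
    degreeSum G ≡ deg G v + deg G v + degreeSum (delete v G)
  degreeSum-delete v G = begin
    degreeSum G
      ≡⟨ sum-remove {i = v} (deg G) ⟩
    deg G v + sum (λ u → deg G (punchIn v u))
      ≡⟨ cong (deg G v +_) (sum-cong-≗ λ u → sum-remove {i = v} (adj G (punchIn v u))) ⟩
    deg G v + sum (λ u → adj G (punchIn v u) v + deg (delete v G) u)
      ≡⟨ cong (deg G v +_) (∑-distrib-+ (λ u → adj G (punchIn v u) v) (deg (delete v G))) ⟩
    deg G v + (sum (λ u → adj G (punchIn v u) v) + degreeSum (delete v G))
      ≡⟨ cong (λ x → deg G v + (x + degreeSum (delete v G))) column ⟩
    deg G v + (deg G v + degreeSum (delete v G))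
      ≡⟨ +-assoc (deg G v) _ _ ⟨
    deg G v + deg G v + degreeSum (delete v G) ∎
    where
    open ≡-Reasoning
    column : sum (λ u → adj G (punchIn v u) v) ≡ deg G v
    column = sym (trans (sum-remove {i = v} (adj G v))
      (cong₂ _+_ (adj-irrefl G v) (sum-cong-≗ λ u → adj-sym G v (punchIn v u))))

  blowup : ∀ q → Graph m → Graph (m * q)
  blowup q = pullback (quotient q)

  quotient-combine : ∀ {q} (i : Fin m) (j : Fin q) → quotient q (combine i j) ≡ i
  quotient-combine i j = cong proj₁ (remQuot-combine i j)

  deg-blowup : ∀ q (H : Graph m) v → deg (blowup q H) v ≡ q * deg H (quotient q v)
  deg-blowup {m} q H v = begin
    deg (blowup q H) v
      ≡⟨ sum-combine m _ ⟩
    sum (λ i → sum (λ j → adj H (quotient q v) (quotient q (combine {m} i j))))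
      ≡⟨ sum-cong-≗ {m} (λ i → trans (sum-cong-≗ {q} λ j → cong (adj H (quotient q v)) (quotient-combine i j)) (sum-const q _)) ⟩
    sum (λ i → q * adj H (quotient q v) i)
      ≡⟨ sum-*ˡ {m} q _ ⟩
    q * deg H (quotient q v) ∎
    where open ≡-Reasoning

  -- The classes that an independent set meets form an independent set of `H`, and each class
  -- contributes at most `q` vertices.
  blowup-independence : ∀ {B} q (H : Graph m) →
    IndependenceAtMost H B → IndependenceAtMost (blowup q H) (q * B)
  blowup-independence {m} {B} q H h s indep = begin
    sum (ind ∘ s)
      ≡⟨ sum-combine m _ ⟩
    sum (λ i → sum (λ j → ind (s (combine {m} i j))))
      ≤⟨ sum-mono fibre ⟩
    sum (λ i → q * ind (s′ i))
      ≡⟨ sum-*ˡ {m} q _ ⟩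
    q * sum (ind ∘ s′)
      ≤⟨ *-monoʳ-≤ q (h s′ indep′) ⟩
    q * B ∎
    where
    open ≤-Reasoning
    open Graph H
    meets? : ∀ i → Dec (∃[ j ] T (s (combine i j)))
    meets? i = any? λ j → T? (s (combine i j))
    s′ : Fin m → Bool
    s′ i = does (meets? i)
    fibre : ∀ i → sum (λ j → ind (s (combine i j))) ≤ q * ind (s′ i)
    fibre i with meets? i
    ... | yes _ = ≤-trans (sum-mono λ j → ind≤1 (s (combine i j))) (≤-reflexive (sum-const q 1))
    ... | no ¬p = ≤-trans (sum-mono λ j → zero-at j) (≤-reflexive (sum-const q 0))
      where
      zero-at : ∀ j → ind (s (combine i j)) ≤ 0
      zero-at j with s (combine i j) in eq
      ... | false = z≤n
      ... | true  = contradiction (j , subst T (sym eq) _) ¬p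
    indep′ : IndependentMap H s′
    indep′ x y sx sy with meets? x | meets? y
    ... | yes (i , si) | yes (j , sj) = λ x~y → indep _ _ si sj
      (subst₂ _~_ (sym (quotient-combine x i)) (sym (quotient-combine y j)) x~y)

  -- Joins, disjoint unions and complete graphs

  module _ (x : Bool) (G : Graph m) (H : Graph n) where
    private
      module G = Graph G
      module H = Graph H

      Adjacent : Fin m ⊎ Fin n → Fin m ⊎ Fin n → Set
      Adjacent (inj₁ u) (inj₁ v) = u G.~ v
      Adjacent (inj₂ u) (inj₂ v) = u H.~ v
      Adjacent _        _        = T x

      adjacent? : ∀ u v → Dec (Adjacent u v)
      adjacent? (inj₁ u) (inj₁ v) = u G.~? v
      adjacent? (inj₂ u) (inj₂ v) = u H.~? v
      adjacent? (inj₁ _) (inj₂ _) = T? x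
      adjacent? (inj₂ _) (inj₁ _) = T? x

      adjacent-sym : ∀ u v → Adjacent u v → Adjacent v u
      adjacent-sym (inj₁ u) (inj₁ v) = G.~-sym
      adjacent-sym (inj₂ u) (inj₂ v) = H.~-sym
      adjacent-sym (inj₁ _) (inj₂ _) = id
      adjacent-sym (inj₂ _) (inj₁ _) = id

      adjacent-irrefl : ∀ u → ¬ Adjacent u u
      adjacent-irrefl (inj₁ u) = G.~-irrefl refl
      adjacent-irrefl (inj₂ u) = H.~-irrefl refl

    -- The join of G and H for x = true, their disjoint union for x = false.
    glue : Graph (m + n)
    glue = record
      { _~_      = λ u v → Adjacent (splitAt m u) (splitAt m v)
      ; _~?_     = λ u v → adjacent? (splitAt m u) (splitAt m v)
      ; ~-sym    = λ {u} {v} → adjacent-sym (splitAt m u) (splitAt m v)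
      ; ~-irrefl = λ { {u} refl → adjacent-irrefl (splitAt m u) }
      }

    open Graph glue

    glue-↑ˡ : ∀ {u v} → (u ↑ˡ n) ~ (v ↑ˡ n) ≡ u G.~ v
    glue-↑ˡ {u} {v} = cong₂ Adjacent (splitAt-↑ˡ m u n) (splitAt-↑ˡ m v n)

    glue-↑ʳ : ∀ {u v} → (m ↑ʳ u) ~ (m ↑ʳ v) ≡ u H.~ v
    glue-↑ʳ {u} {v} = cong₂ Adjacent (splitAt-↑ʳ m n u) (splitAt-↑ʳ m n v)

    private
      ind-adjacent : Fin m ⊎ Fin n → Fin m ⊎ Fin n → ℕ
      ind-adjacent u v = ind (does (adjacent? u v))

    deg-glueˡ : ∀ u → deg glue (u ↑ˡ n) ≡ deg G u + n * ind x
    deg-glueˡ u = trans (sum-↑ m _) (cong₂ _+_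
      (sum-cong-≗ λ v → cong₂ ind-adjacent (splitAt-↑ˡ m u n) (splitAt-↑ˡ m v n))
      (trans (sum-cong-≗ λ v → cong₂ ind-adjacent (splitAt-↑ˡ m u n) (splitAt-↑ʳ m n v)) (sum-const n (ind x))))

    deg-glueʳ : ∀ u → deg glue (m ↑ʳ u) ≡ m * ind x + deg H u
    deg-glueʳ u = trans (sum-↑ m _) (cong₂ _+_
      (trans (sum-cong-≗ λ v → cong₂ ind-adjacent (splitAt-↑ʳ m n u) (splitAt-↑ˡ m v n)) (sum-const m (ind x)))
      (sum-cong-≗ λ v → cong₂ ind-adjacent (splitAt-↑ʳ m n u) (splitAt-↑ʳ m n v)))

    glue-independence : ∀ {B C} → IndependenceAtMost G B → IndependenceAtMost H C →
      IndependenceAtMost glue (B + C)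
    glue-independence hG hH s indep = ≤-trans (≤-reflexive (sum-↑ m _)) (+-mono-≤
      (hG (s ∘ (_↑ˡ n)) λ u v su sv u~v → indep _ _ su sv (subst id (sym glue-↑ˡ) u~v))
      (hH (s ∘ (m ↑ʳ_)) λ u v su sv u~v → indep _ _ su sv (subst id (sym glue-↑ʳ) u~v)))

  K-independence : IndependenceAtMost (K n) 1
  K-independence {zero}  s indep = z≤n
  K-independence {suc n} s indep with s zero in eq
  ... | false = K-independence (s ∘ suc) λ u v su sv u≢v → indep (suc u) (suc v) su sv λ { refl → u≢v refl }
  ... | true  = s≤s (≤-trans (sum-mono rest) (≤-reflexive (trans (sum-const n 0) (*-zeroʳ n))))
    where
    rest : ∀ i → ind (s (suc i)) ≤ 0
    rest i with s (suc i) in eq′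
    ... | false = z≤n
    ... | true  = contradiction (λ ()) (indep zero (suc i) (subst T (sym eq) _) (subst T (sym eq′) _))

  deg-K : ∀ (u : Fin (suc n)) → deg (K (suc n)) u ≡ n
  deg-K {n} u = trans (sum-remove {i = u} (adj (K (suc n)) u)) (cong₂ _+_ (adj-irrefl (K (suc n)) u)
    (trans (sum-cong-≗ λ v → cong ind (dec-true (¬? (u ≟ᶠ punchIn u v)) λ eq → punchInᵢ≢i u v (sym eq)))
           (trans (sum-const n 1) (*-identityʳ n))))

  -- Powers of cycles and clique-free cuts

  toℕ-distance : ∀ k (u v : Fin n) → toℕ u ≤ toℕ v → toℕ v ≤ toℕ u + k →
    DistanceAtMost (Cycle n) k u v
  toℕ-distance zero    u v u≤v v≤u = toℕ-injective (≤-antisym u≤v (subst (toℕ v ≤_) (+-identityʳ _) v≤u))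
  toℕ-distance (suc k) u v u≤v v≤ with toℕ v ≤? toℕ u + k
  ... | yes v≤u+k = inj₁ (toℕ-distance k u v u≤v v≤u+k)
  ... | no  v≰u+k = inj₂ (previous v v≤ v≰u+k)
    where
    previous : ∀ {n} {u : Fin n} v → toℕ v ≤ toℕ u + suc k → ¬ toℕ v ≤ toℕ u + k →
      ∃[ w ] DistanceAtMost (Cycle n) k u w × Graph._~_ (Cycle n) w v
    previous         zero    v≤ v≰ = contradiction z≤n v≰
    previous {u = u} (suc v) v≤ v≰ =
      inject₁ v ,
      toℕ-distance k u (inject₁ v)
        (subst (toℕ u ≤_) (sym (toℕ-inject₁ v)) (≤-trans (m≤m+n (toℕ u) k) (≤-pred (≰⇒> v≰))))
        (subst (_≤ toℕ u + k) (sym (toℕ-inject₁ v)) (≤-pred (subst (suc (toℕ v) ≤_) (+-suc (toℕ u) k) v≤))) ,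
      (λ eq → 1+n≢n (trans (sym (cong toℕ eq)) (toℕ-inject₁ v))) ,
      inj₁ (inj₁ (cong suc (sym (toℕ-inject₁ v))))

  -- The linear order of positions is enough below, because the contradiction comes from a single
  -- stretch of the cycle leading from one side of the cut to the other.
  cyclePower-adjacent : ∀ {r} (u v : Fin n) → toℕ u < toℕ v → toℕ v ≤ toℕ u + r →
    Graph._~_ (power (Cycle n) r) u v
  cyclePower-adjacent {r = r} u v u<v v≤ = (λ eq → <⇒≢ u<v (cong toℕ eq)) , toℕ-distance r u v (<⇒≤ u<v) v≤

  -- The vertices labelled nothing form a cut whose two sides are labelled true and false.
  cliqueFreeCut⇒¬hamiltonCyclePower : ∀ {r} (G : Graph n) (label : Fin n → Maybe Bool) → let open Graph G in
    (∀ {u v b c} → label u ≡ just b → label v ≡ just c → u ~ v → b ≡ c) →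
    (∀ (g : Fin r → Fin n) → (∀ i → label (g i) ≡ nothing) → ¬ (∀ i j → i ≢ j → g i ~ g j)) →
    (∃[ u ] label u ≡ just true) → (∃[ v ] label v ≡ just false) →
    ¬ HasHamiltonCyclePower r G
  cliqueFreeCut⇒¬hamiltonCyclePower {n} {r} G label separated cliqueFree (u , lu) (v , lv) (f , inj , hom)
    -- The copy is spanning, so both labelled vertices occur at some positions `x` and `y` of the
    -- cycle.
    with injective⇒surjective inj u | injective⇒surjective inj v
  ... | x , refl | y , refl = case-order (<-cmp x y)
    where
    open Graph G

    L : Fin n → Maybe Bool
    L i = label (f i)

    Crossing : Fin n → Fin n → Set
    Crossing i j = ∃[ b ] ∃[ c ] L i ≡ just b × L j ≡ just c × b ≢ c

    inner? : ∀ i j → Dec (∃[ k ] toℕ i < toℕ k × toℕ k < toℕ j × L k ≢ nothing)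
    inner? i j = any? λ k → (i <? k) ×-dec (k <? j) ×-dec ¬? (≡-dec _≟ᵇ_ (L k) nothing)

    edge : ∀ {i j} → toℕ i < toℕ j → toℕ j ≤ toℕ i + r → f i ~ f j
    edge {i} {j} i<j j≤ = hom i j (cyclePower-adjacent i j i<j j≤)

    -- Otherwise the `r` positions right after `i` all come before `j`, hence lie in the cut. Any
    -- two of them are less than `r` apart, so they form a clique.
    gap≤r : ∀ i j → ¬ (∃[ k ] toℕ i < toℕ k × toℕ k < toℕ j × L k ≢ nothing) → ¬ (toℕ i + r < toℕ j)
    gap≤r i j clear far = cliqueFree (f ∘ g) g-cut g-clique
      where
      g : Fin r → Fin n
      g t = fromℕ< {suc (toℕ i + toℕ t)} (≤-trans (s≤s (+-monoʳ-< (toℕ i) (toℕ<n t))) (≤-trans far (<⇒≤ (toℕ<n j))))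
      toℕ-g : ∀ t → toℕ (g t) ≡ suc (toℕ i + toℕ t)
      toℕ-g t = toℕ-fromℕ< _
      g-cut : ∀ t → L (g t) ≡ nothing
      g-cut t with ≡-dec _≟ᵇ_ (L (g t)) nothing
      ... | yes eq = eq
      ... | no neq = contradiction (g t , subst (toℕ i <_) (sym (toℕ-g t)) (s≤s (m≤m+n _ _)) ,
        subst (_< toℕ j) (sym (toℕ-g t)) (≤-trans (s≤s (+-monoʳ-< (toℕ i) (toℕ<n t))) far) , neq) clear
      g-edge : ∀ s t → toℕ s < toℕ t → f (g s) ~ f (g t)
      g-edge s t s<t = edge (subst₂ _<_ (sym (toℕ-g s)) (sym (toℕ-g t)) (s≤s (+-monoʳ-< (toℕ i) s<t)))
        (subst₂ (λ a b → b ≤ a + r) (sym (toℕ-g s)) (sym (toℕ-g t))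
          (s≤s (≤-trans (+-monoʳ-≤ (toℕ i) (<⇒≤ (toℕ<n t))) (+-monoˡ-≤ r (m≤m+n (toℕ i) (toℕ s))))))
      g-clique : ∀ s t → s ≢ t → f (g s) ~ f (g t)
      g-clique s t s≢t with <-cmp s t
      ... | tri< s<t _ _ = g-edge s t s<t
      ... | tri≈ _ s≡t _ = contradiction s≡t s≢t
      ... | tri> _ _ t<s = ~-sym (g-edge t s t<s)

    -- A position outside the cut strictly between i and j is the end of a shorter crossing.
    noCrossing : ∀ fuel i j → toℕ i < toℕ j → toℕ j ≤ toℕ i + fuel → ¬ Crossing i j
    noCrossing zero i j i<j j≤ _ = contradiction (subst (toℕ j ≤_) (+-identityʳ _) j≤) (<⇒≱ i<j)
    noCrossing (suc fuel) i j i<j j≤ (b , c , Li , Lj , b≢c) with inner? i j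
    -- Everything strictly between `i` and `j` lies in the cut. Near ends are adjacent, against
    -- `separated`; far ends leave room for a clique in the cut.
    ... | no clear with toℕ j ≤? toℕ i + r
    ...   | yes near = b≢c (separated Li Lj (edge i<j near))
    ...   | no  far  = gap≤r i j clear (≰⇒> far)
    noCrossing (suc fuel) i j i<j j≤ (b , c , Li , Lj , b≢c) | yes (k , i<k , k<j , Lk≢) with L k in Lk
    ... | nothing = Lk≢ refl
    ... | just e with b ≟ᵇ e
    ...   | yes refl = noCrossing fuel k j k<j
              (≤-trans (subst (toℕ j ≤_) (+-suc (toℕ i) fuel) j≤) (+-monoˡ-≤ fuel i<k)) (b , c , Lk , Lj , b≢c)
    ...   | no b≢e = noCrossing fuel i k i<k
              (≤-pred (≤-trans k<j (subst (toℕ j ≤_) (+-suc (toℕ i) fuel) j≤))) (b , e , Li , Lk , b≢e)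

    case-order : Tri (toℕ x < toℕ y) (x ≡ y) (toℕ y < toℕ x) → _
    case-order (tri< x<y _ _) = noCrossing (toℕ y) x y x<y (m≤n+m _ _) (true , false , lu , lv , λ ())
    case-order (tri> _ _ y<x) = noCrossing (toℕ x) y x y<x (m≤n+m _ _) (false , true , lv , lu , λ ())
    case-order (tri≈ _ refl _) with () ← trans (sym lu) lv

-- Rational arithmetic

open import Data.Rational
import Data.Rational.Properties as ℚ
open import Data.Rational.Unnormalised using (mkℚᵘ; *≤*; *≡*)
  renaming (_≃_ to _≃ᵘ_; _+_ to _+ᵘ_; _*_ to _*ᵘ_; -_ to -ᵘ_)
import Data.Rational.Unnormalised.Properties as ℚᵘ

fromℤ : ℤ → ℚ
fromℤ i = i / 1

fromℤ≃ : ∀ i → toℚᵘ (fromℤ i) ≃ᵘ mkℚᵘ i 0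
fromℤ≃ i = ℚ.toℚᵘ-fromℚᵘ (mkℚᵘ i 0)

fromℤ-+ : ∀ i j → fromℤ (i ℤ.+ j) ≡ fromℤ i + fromℤ j
fromℤ-+ i j = ℚ.toℚᵘ-injective (begin
  toℚᵘ (fromℤ (i ℤ.+ j))             ≈⟨ fromℤ≃ (i ℤ.+ j) ⟩
  mkℚᵘ (i ℤ.+ j) 0                   ≈⟨ *≡* (cong (ℤ._* ℤ.1ℤ) (sym (cong₂ ℤ._+_ (ℤ.*-identityʳ i) (ℤ.*-identityʳ j)))) ⟩
  mkℚᵘ i 0 +ᵘ mkℚᵘ j 0               ≈⟨ ℚᵘ.+-cong (fromℤ≃ i) (fromℤ≃ j) ⟨
  toℚᵘ (fromℤ i) +ᵘ toℚᵘ (fromℤ j)   ≈⟨ ℚ.toℚᵘ-homo-+ (fromℤ i) (fromℤ j) ⟨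
  toℚᵘ (fromℤ i + fromℤ j)           ∎)
  where open ℚᵘ.≃-Reasoning

fromℤ-* : ∀ i j → fromℤ (i ℤ.* j) ≡ fromℤ i * fromℤ j
fromℤ-* i j = ℚ.toℚᵘ-injective (begin
  toℚᵘ (fromℤ (i ℤ.* j))             ≈⟨ fromℤ≃ (i ℤ.* j) ⟩
  mkℚᵘ i 0 *ᵘ mkℚᵘ j 0               ≈⟨ ℚᵘ.*-cong (fromℤ≃ i) (fromℤ≃ j) ⟨
  toℚᵘ (fromℤ i) *ᵘ toℚᵘ (fromℤ j)   ≈⟨ ℚ.toℚᵘ-homo-* (fromℤ i) (fromℤ j) ⟨
  toℚᵘ (fromℤ i * fromℤ j)           ∎)
  where open ℚᵘ.≃-Reasoning

fromℤ-neg : ∀ i → fromℤ (ℤ.- i) ≡ - fromℤ i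
fromℤ-neg i = ℚ.toℚᵘ-injective (begin
  toℚᵘ (fromℤ (ℤ.- i))   ≈⟨ fromℤ≃ (ℤ.- i) ⟩
  -ᵘ mkℚᵘ i 0            ≈⟨ ℚᵘ.-‿cong (fromℤ≃ i) ⟨
  -ᵘ toℚᵘ (fromℤ i)      ≈⟨ ℚ.toℚᵘ-homo‿- (fromℤ i) ⟨
  toℚᵘ (- fromℤ i)       ∎)
  where open ℚᵘ.≃-Reasoning

ℚ-ring : AlmostCommutativeRing _ _
ℚ-ring = fromCommutativeRing ℚ.+-*-commutativeRing

fromℤ-morphism : ℤ.+-*-rawRing -Raw-AlmostCommutative⟶ ℚ-ring
fromℤ-morphism = record
  { ⟦_⟧    = fromℤ
  ; +-homo = fromℤ-+
  ; *-homo = fromℤ-*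
  ; -‿homo = fromℤ-neg
  ; 0-homo = refl
  ; 1-homo = refl
  }

fromℤ-≟ : WeaklyDecidable (Induced-equivalence fromℤ-morphism)
fromℤ-≟ i j = Maybe.map (cong fromℤ) (dec⇒maybe (i ℤ.≟ j))

-- A ring solver for ℚ with integer coefficients; computing with rational ones is far too slow.
module ℚ-Solver = Algebra.Solver.Ring ℤ.+-*-rawRing ℚ-ring fromℤ-morphism fromℤ-≟
open ℚ-Solver using (Polynomial; con; solve; _:=_; _:+_; _:*_; _:-_; :-_)

:1 : Polynomial n
:1 = con ℤ.1ℤ

-- An opaque copy of fromℕ: conversion checking would otherwise unfold the gcds in fromℕ.
opaque
  ι : ℕ → ℚ
  ι = fromℕ

  ι≡fromℕ : ∀ n → ι n ≡ fromℕ n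
  ι≡fromℕ _ = refl

  ι-0 : ι 0 ≡ 0ℚ
  ι-0 = refl

  ι-+ : ∀ m n → ι (m ℕ.+ n) ≡ ι m + ι n
  ι-+ m n = trans (cong fromℤ (ℤ.pos-+ m n)) (fromℤ-+ (ℤ.+ m) (ℤ.+ n))

  ι-* : ∀ m n → ι (m ℕ.* n) ≡ ι m * ι n
  ι-* m n = trans (cong fromℤ (ℤ.pos-* m n)) (fromℤ-* (ℤ.+ m) (ℤ.+ n))

  ι-suc : ∀ n → ι (suc n) ≡ 1ℚ + ι n
  ι-suc = ι-+ 1

  ι-mono : ∀ {m n} → m ℕ.≤ n → ι m ≤ ι n
  ι-mono {m} {n} m≤n = ℚ.toℚᵘ-cancel-≤ (ℚᵘ.≤-trans (ℚᵘ.≤-reflexive (fromℤ≃ (ℤ.+ m)))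
    (ℚᵘ.≤-trans (*≤* (ℤ.*-monoʳ-≤-nonNeg ℤ.1ℤ (ℤ.+≤+ m≤n))) (ℚᵘ.≤-reflexive (ℚᵘ.≃-sym (fromℤ≃ (ℤ.+ n))))))

  -- The numerator of a nonnegative rational bounds it, as the denominator is at least 1.
  archimedean : ∀ p → ∃[ n ] p ≤ ι n
  archimedean (mkℚ (ℤ.+ a) d _) = a , ℚ.toℚᵘ-cancel-≤
    (ℚᵘ.≤-trans (*≤* (ℤ.*-monoˡ-≤-nonNeg (ℤ.+ a) (ℤ.+≤+ (s≤s z≤n)))) (ℚᵘ.≤-reflexive (ℚᵘ.≃-sym (fromℤ≃ (ℤ.+ a)))))
  archimedean p@(mkℚ (ℤ.-[1+ a ]) d _) = 0 , ℚ.nonPositive⁻¹ p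

0≤ι : ∀ n → 0ℚ ≤ ι n
0≤ι n = subst (_≤ ι n) ι-0 (ι-mono z≤n)

-- Inequalities are certified by a visibly nonnegative expression for the difference, which
-- the ring solver checks.
≤-fromDiff : ∀ {x y e} → 0ℚ ≤ e → y ≡ x + e → x ≤ y
≤-fromDiff {x} {y} {e} 0≤e refl = subst (_≤ x + e) (ℚ.+-identityʳ x) (ℚ.+-monoʳ-≤ x 0≤e)

0≤y-x : ∀ {x y} → x ≤ y → 0ℚ ≤ y - x
0≤y-x {x} {y} x≤y = subst (_≤ y - x) (ℚ.+-inverseʳ x) (ℚ.+-monoˡ-≤ (- x) x≤y)

0<y-x : ∀ {x y} → x < y → 0ℚ < y - x
0<y-x {x} {y} x<y = subst (_< y - x) (ℚ.+-inverseʳ x) (ℚ.+-monoˡ-< (- x) x<y)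

0≤+ : ∀ {x y} → 0ℚ ≤ x → 0ℚ ≤ y → 0ℚ ≤ x + y
0≤+ = ℚ.+-mono-≤

0≤* : ∀ {x y} → 0ℚ ≤ x → 0ℚ ≤ y → 0ℚ ≤ x * y
0≤* {x} {y} 0≤x 0≤y = subst (_≤ x * y) (ℚ.*-zeroʳ x) (ℚ.*-monoˡ-≤-nonNeg x ⦃ nonNegative 0≤x ⦄ 0≤y)

0<* : ∀ {x y} → 0ℚ < x → 0ℚ < y → 0ℚ < x * y
0<* {x} {y} 0<x 0<y = subst (_< x * y) (ℚ.*-zeroʳ x) (ℚ.*-monoʳ-<-pos x ⦃ positive 0<x ⦄ 0<y)

ι-cancel-≤ : ∀ {m n} → ι m ≤ ι n → m ℕ.≤ n
ι-cancel-≤ {m} {n} m≤n with m ℕ.≤? n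
... | yes p = p
... | no ¬p = contradiction (ℚ.<-≤-trans n<1+n (ℚ.≤-trans (ι-mono (ℕ.≰⇒> ¬p)) m≤n)) (ℚ.<-irrefl refl)
  where
  n<1+n : ι n < ι (suc n)
  n<1+n = subst₂ _<_ (ℚ.+-identityˡ (ι n)) (sym (ι-suc n)) (ℚ.+-monoˡ-< (ι n) (ℚ.positive⁻¹ 1ℚ))

0<ι : ∀ {n} → 1 ℕ.≤ n → 0ℚ < ι n
0<ι {suc n} _ = subst (0ℚ <_) (sym (ι-suc n)) (ℚ.+-mono-<-≤ (ℚ.positive⁻¹ 1ℚ) (0≤ι n))

-- If `y < x`, some `m` lies strictly between them and the slack `m - y` is too small. This turns
-- `≤ᴿ` between constant sequences into `≤`.
≤-fromSlack : ∀ {x y} → (∀ ε → 0ℚ < ε → x ≤ y + ε) → x ≤ y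
≤-fromSlack {x} {y} h with x ℚ.≤? y
... | yes p = p
... | no ¬p with m , y<m , m<x ← ℚ.<-dense (ℚ.≰⇒> ¬p) =
  contradiction (ℚ.≤-<-trans (subst (x ≤_) (eq y m) (h (m - y) (0<y-x y<m))) m<x) (ℚ.<-irrefl refl)
  where
  eq : ∀ y m → y + (m - y) ≡ m
  eq = solve 2 (λ y m → y :+ (m :- y) := m) refl

÷₀-* : ∀ p {q} → 0ℚ < q → (p ÷₀ q) * q ≡ p
÷₀-* p {q} 0<q with q ℚ.≟ 0ℚ
... | yes refl = contradiction 0<q (ℚ.<-irrefl refl)
... | no q≢0   = trans (ℚ.*-assoc p _ q) (trans (cong (p *_) (ℚ.*-inverseˡ q)) (ℚ.*-identityʳ p))
  where instance _ = ≢-nonZero q≢0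

archimedean-* : ∀ {e} → 0ℚ < e → ∀ x → ∃[ s ] x ≤ e * ι s
archimedean-* {e} 0<e x with s , h ← archimedean (x ÷₀ e) =
  s , subst (_≤ e * ι s) (trans (ℚ.*-comm e _) (÷₀-* x 0<e)) (ℚ.*-monoˡ-≤-nonNeg e ⦃ nonNegative (ℚ.<⇒≤ 0<e) ⦄ h)

-- Induction on `x`: since `c` is at least 1, raising `x` by 1 raises the quotient by at most 1, so
-- only `q` and `suc q` have to be tried.
floor-÷ : ∀ {c} → 1ℚ ≤ c → ∀ x → ∃[ q ] c * ι q ≤ ι x × ι x ≤ c * ι (suc q)
floor-÷ {c} 1≤c zero =
  0 , ℚ.≤-reflexive (trans (cong (c *_) ι-0) (trans (ℚ.*-zeroʳ c) (sym ι-0))) ,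
  subst (_≤ c * ι 1) (sym ι-0) (0≤* (ℚ.≤-trans (ℚ.<⇒≤ (ℚ.positive⁻¹ 1ℚ)) 1≤c) (0≤ι 1))
floor-÷ {c} 1≤c (suc x) with floor-÷ 1≤c x
... | q , lower , upper with c * ι (suc q) ℚ.≤? ι (suc x)
...   | yes p = suc q , p , ≤-fromDiff (0≤+ (0≤y-x upper) (0≤y-x 1≤c))
          (trans (cong (c *_) (ι-suc (suc q)))
            (trans (eq c (ι (suc q)) (ι x)) (cong (_+ (c * ι (suc q) - ι x + (c - 1ℚ))) (sym (ι-suc x)))))
  where
  eq : ∀ c q x → c * (1ℚ + q) ≡ 1ℚ + x + (c * q - x + (c - 1ℚ))
  eq = solve 3 (λ c q x → c :* (:1 :+ q) := :1 :+ x :+ (c :* q :- x :+ (c :- :1))) refl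
...   | no ¬p = q , ℚ.≤-trans lower (ι-mono (ℕ.n≤1+n x)) , ℚ.<⇒≤ (ℚ.≰⇒> ¬p)

choose2 : ∀ n → (n C 2) ℕ.+ (n C 2) ℕ.+ n ≡ n ℕ.* n
choose2 zero = refl
choose2 (suc n) = begin
  (suc n C 2) ℕ.+ (suc n C 2) ℕ.+ suc n
    ≡⟨ cong (λ c → c ℕ.+ c ℕ.+ suc n) (trans (sym (nCk+nC[k+1]≡[n+1]C[k+1] n 1)) (cong (ℕ._+ (n C 2)) (nC1≡n n))) ⟩
  (n ℕ.+ (n C 2)) ℕ.+ (n ℕ.+ (n C 2)) ℕ.+ suc n
    ≡⟨ rearrange n (n C 2) ⟩
  (n C 2) ℕ.+ (n C 2) ℕ.+ n ℕ.+ (n ℕ.+ suc n)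
    ≡⟨ cong (ℕ._+ (n ℕ.+ suc n)) (choose2 n) ⟩
  n ℕ.* n ℕ.+ (n ℕ.+ suc n)
    ≡⟨ square n ⟩
  suc n ℕ.* suc n ∎
  where
  open ≡-Reasoning
  rearrange : ∀ n c → (n ℕ.+ c) ℕ.+ (n ℕ.+ c) ℕ.+ suc n ≡ c ℕ.+ c ℕ.+ n ℕ.+ (n ℕ.+ suc n)
  rearrange = ℕ-solver.solve-∀
  square : ∀ n → n ℕ.* n ℕ.+ (n ℕ.+ suc n) ≡ suc n ℕ.* suc n
  square = ℕ-solver.solve-∀

-- From edge density to minimum degree

-- Deleting a vertex of degree below dk from a graph on k vertices does not decrease
-- degreeSum − d k(k+1).
denseSubgraph : ∀ {r B} (d γ : ℚ) k (G : Graph k) → CliqueFree G r → IndependenceAtMost G B →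
  d * (ι k * (1ℚ + ι k)) + γ ≤ ι (degreeSum G) →
  ∃[ m ] Σ[ H ∈ Graph m ] CliqueFree H r × IndependenceAtMost H B ×
    (∀ v → d * ι m ≤ ι (deg H v)) ×
    d * (ι m * (1ℚ + ι m)) + γ ≤ ι (degreeSum H)
denseSubgraph d γ k G free indep dense with all? (λ v → d * ι k ℚ.≤? ι (deg G v))
... | yes large = k , G , free , indep , large , dense
denseSubgraph d γ zero    G free indep dense | no ¬large = contradiction (λ ()) ¬large
denseSubgraph d γ (suc k) G free indep dense | no ¬large
  with v , small ← ¬∀⟶∃¬ (suc k) _ (λ v → d * ι (suc k) ℚ.≤? ι (deg G v)) ¬large =
  denseSubgraph d γ k (delete v G) (pullback-cliqueFree (punchIn v) G free) (delete-independence v G indep)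
    (drop d (ι k) (ι (deg G v)) (ι (degreeSum (delete v G))) γ
      (subst₂ (λ x y → d * (x * (1ℚ + x)) + γ ≤ y) (ι-suc k) degreeSum≡ dense)
      (subst (λ x → ι (deg G v) ≤ d * x) (ι-suc k) (ℚ.<⇒≤ (ℚ.≰⇒> small))))
  where
  degreeSum≡ : ι (degreeSum G) ≡ ι (deg G v) + ι (deg G v) + ι (degreeSum (delete v G))
  degreeSum≡ = trans (cong ι (degreeSum-delete v G))
    (trans (ι-+ (deg G v ℕ.+ deg G v) (degreeSum (delete v G)))
      (cong (_+ ι (degreeSum (delete v G))) (ι-+ (deg G v) (deg G v))))
  -- With `j = k` the deletion costs at most `2d(k + 1)`, and
  -- `(k + 1)(k + 2) − 2(k + 1) = k(k + 1)`.
  drop : ∀ d j g D γ → d * ((1ℚ + j) * (1ℚ + (1ℚ + j))) + γ ≤ g + g + D → g ≤ d * (1ℚ + j) →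
    d * (j * (1ℚ + j)) + γ ≤ D
  drop d j g D γ h g≤ = ≤-fromDiff (0≤+ (0≤y-x h) (0≤+ (0≤y-x g≤) (0≤y-x g≤))) (eq d j g D γ)
    where
    eq : ∀ d j g D γ → D ≡ d * (j * (1ℚ + j)) + γ +
      (g + g + D - (d * ((1ℚ + j) * (1ℚ + (1ℚ + j))) + γ) + (d * (1ℚ + j) - g + (d * (1ℚ + j) - g)))
    eq = solve 5 (λ d j g D γ → D := d :* (j :* (:1 :+ j)) :+ γ :+
      (g :+ g :+ D :- (d :* ((:1 :+ j) :* (:1 :+ (:1 :+ j))) :+ γ) :+ (d :* (:1 :+ j) :- g :+ (d :* (:1 :+ j) :- g)))) refl

-- Dense clique-free graphs from the Ramsey-Turán density

halve : ∀ {x} → 0ℚ < x → ∃[ h ] 0ℚ < h × h + h ≡ x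
halve {x} 0<x = ½ * x , 0<* (ℚ.positive⁻¹ ½) 0<x , trans (sym (ℚ.*-distribʳ-+ x ½ ½)) (ℚ.*-identityˡ x)

1≤nC2 : ∀ {n} → 2 ℕ.≤ n → 1 ℕ.≤ n C 2
1≤nC2 {n} 2≤n with n C 2 | choose2 n
... | suc _ | _  = s≤s z≤n
... | zero  | eq = contradiction (subst (2 ℕ.* n ℕ.≤_) (sym eq) (ℕ.*-monoˡ-≤ n 2≤n))
                     (ℕ.<⇒≱ (ℕ.m<m+n n (ℕ.≤-trans (ℕ.≤-trans (ℕ.n≤1+n 1) 2≤n) (ℕ.m≤m+n n 0))))

-- Each `e + e` is the tolerance in `Within e` plus the slack `e` at which `≤ᴿ` is evaluated.
≤-chain : ∀ ρ e ℓ x → ℓ - x ≤ e + e → ρ - ℓ ≤ e + e → ρ - (e + e + (e + e)) ≤ x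
≤-chain ρ e ℓ x ℓ≤ ρ≤ = ≤-fromDiff (0≤+ (0≤y-x ℓ≤) (0≤y-x ρ≤)) (eq ρ e ℓ x)
  where
  eq : ∀ ρ e ℓ x → x ≡ ρ - (e + e + (e + e)) + (e + e - (ℓ - x) + (e + e - (ρ - ℓ)))
  eq = solve 4 (λ ρ e ℓ x → x := ρ :- (e :+ e :+ (e :+ e)) :+ (e :+ e :- (ℓ :- x) :+ (e :+ e :- (ρ :- ℓ)))) refl

≤-÷₀ : ∀ {x k c} → 1 ℕ.≤ c → x ≤ fromℕ k ÷₀ fromℕ c → x * ι c ≤ ι k
≤-÷₀ {x} {k} {c} 1≤c x≤ = ℚ.≤-trans
  (ℚ.*-monoʳ-≤-nonNeg (ι c) ⦃ nonNegative (0≤ι c) ⦄ (subst₂ (λ k c → x ≤ k ÷₀ c) (sym (ι≡fromℕ k)) (sym (ι≡fromℕ c)) x≤))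
  (ℚ.≤-reflexive (÷₀-* (ι k) (0<ι 1≤c)))

ramseyTuránGraph : ∀ {h} {H : Graph h} {e a ρ ℓ k} M → 0ℚ < e → 2 ℕ.≤ M →
  IsRT M H (fromℕ M · fromℚ a) k →
  Within e (fromℚ (fromℕ k ÷₀ fromℕ (M C 2))) ℓ → Within e ℓ (fromℚ ρ) →
  Σ[ G ∈ Graph M ] (H Free) G × ι (independenceNumber G) ≤ ι M * a ×
    (ρ - (e + e + (e + e))) * ι (M C 2) ≤ ι (edgeCount G)
ramseyTuránGraph {e = e} {a} {ρ} {ℓ} {k} M 0<e 2≤M ((G , (free , small) , k≡) , _) (_ , k≈ℓ) (_ , ℓ≈ρ) =
  G , free , independent , edges
  where
  independent : ι (independenceNumber G) ≤ ι M * a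
  independent = subst₂ (λ x y → x ≤ y * a) (sym (ι≡fromℕ (independenceNumber G))) (sym (ι≡fromℕ M))
    (≤-fromSlack λ ε 0<ε → proj₂ (small ε 0<ε) (proj₁ (small ε 0<ε)) ℕ.≤-refl)
  N₁ = proj₁ (k≈ℓ e 0<e)
  N₂ = proj₁ (ℓ≈ρ e 0<e)
  density : ρ - (e + e + (e + e)) ≤ fromℕ k ÷₀ fromℕ (M C 2)
  -- At the index `N₁ ⊔ N₂` the sequence of `ℓ` is close to both the edge density and `ρ`.
  density = ≤-chain ρ e (seq ℓ (N₁ ℕ.⊔ N₂)) (fromℕ k ÷₀ fromℕ (M C 2))
    (proj₂ (k≈ℓ e 0<e) (N₁ ℕ.⊔ N₂) (ℕ.m≤m⊔n N₁ N₂)) (proj₂ (ℓ≈ρ e 0<e) (N₁ ℕ.⊔ N₂) (ℕ.m≤n⊔m N₁ N₂))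
  edges : (ρ - (e + e + (e + e))) * ι (M C 2) ≤ ι (edgeCount G)
  edges = subst (λ k → (ρ - (e + e + (e + e))) * ι (M C 2) ≤ ι k) (sym k≡)
    (≤-÷₀ (1≤nC2 2≤M) density)

-- Lowering the density from ρ − 4e to ρ − 8e pays for the lower order terms and leaves eM².
ramseyTurán⇒dense : ∀ {ρ e M₁} M (G : Graph M) → 0ℚ < e → ρ ≤ e * ι M₁ → M₁ ℕ.≤ M →
  (ρ - (e + e + (e + e))) * ι (M C 2) ≤ ι (edgeCount G) →
  (ρ - (e + e + (e + e) + (e + e + (e + e)))) * (ι M * (1ℚ + ι M)) + e * (ι M * ι M) ≤ ι (degreeSum G)
ramseyTurán⇒dense {ρ} {e} M G 0<e ρ≤ M₁≤M edges =
  bound (ι M) (ι (degreeSum G)) (0≤ι M)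
    (ℚ.≤-trans ρ≤ (ℚ.*-monoˡ-≤-nonNeg e ⦃ nonNegative 0≤e ⦄ (ι-mono M₁≤M)))
    (double (ι M) (ι (M C 2)) (ι (edgeCount G)) (ι (degreeSum G)) choose edges
      (subst (_≤ ι (degreeSum G)) (ι-+ (edgeCount G) (edgeCount G)) (ι-mono (2*edgeCount≤degreeSum G))))
  where
  0≤e = ℚ.<⇒≤ 0<e
  choose : ι (M C 2) + ι (M C 2) + ι M ≡ ι M * ι M
  choose = trans (cong (_+ ι M) (sym (ι-+ (M C 2) (M C 2))))
    (trans (sym (ι-+ ((M C 2) ℕ.+ (M C 2)) M)) (trans (cong ι (choose2 M)) (ι-* M M)))
  double : ∀ M c k D → c + c + M ≡ M * M → (ρ - (e + e + (e + e))) * c ≤ k → k + k ≤ D →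
    (ρ - (e + e + (e + e))) * (M * M - M) ≤ D
  double M c k D choose c≤ k≤ = ≤-fromDiff (0≤+ (0≤y-x k≤) (0≤+ (0≤y-x c≤) (0≤y-x c≤)))
    (trans (eq (ρ - (e + e + (e + e))) M c k D) (cong (λ x → (ρ - (e + e + (e + e))) * (x - M) + _) choose))
    where
    eq : ∀ d M c k D → D ≡ d * (c + c + M - M) + (D - (k + k) + (k - d * c + (k - d * c)))
    eq = solve 5 (λ d M c k D → D := d :* (c :+ c :+ M :- M) :+ (D :- (k :+ k) :+ (k :- d :* c :+ (k :- d :* c)))) refl
  -- The hypothesis `ρ ≤ e * M` absorbs `2ρM`, the difference between `ρ(M² + M)` and `ρ(M² − M)`.
  bound : ∀ M D → 0ℚ ≤ M → ρ ≤ e * M → (ρ - (e + e + (e + e))) * (M * M - M) ≤ D →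
    (ρ - (e + e + (e + e) + (e + e + (e + e)))) * (M * (1ℚ + M)) + e * (M * M) ≤ D
  bound M D 0≤M ρ≤ D≥ = ≤-fromDiff
    (0≤+ (0≤y-x D≥) (0≤* 0≤M (0≤+ (0≤+ (0≤y-x ρ≤) (0≤y-x ρ≤)) (0≤+ (0≤* 0≤e 0≤M) (0≤+ 0≤4e (0≤+ 0≤4e 0≤4e))))))
    (eq ρ e M D)
    where
    0≤4e = 0≤+ (0≤+ 0≤e 0≤e) (0≤+ 0≤e 0≤e)
    eq : ∀ ρ e M D → D ≡ (ρ - (e + e + (e + e) + (e + e + (e + e)))) * (M * (1ℚ + M)) + e * (M * M) +
      (D - (ρ - (e + e + (e + e))) * (M * M - M) +
       M * (e * M - ρ + (e * M - ρ) + (e * M + (e + e + (e + e) + (e + e + (e + e) + (e + e + (e + e)))))))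
    eq = solve 4 (λ ρ e M D → let 4e = e :+ e :+ (e :+ e) in
      D := (ρ :- (4e :+ 4e)) :* (M :* (:1 :+ M)) :+ e :* (M :* M) :+
      (D :- (ρ :- 4e) :* (M :* M :- M) :+
       M :* (e :* M :- ρ :+ (e :* M :- ρ) :+ (e :* M :+ (4e :+ (4e :+ 4e)))))) refl

n≤n² : ∀ n → n ℕ.≤ n ℕ.* n
n≤n² zero    = z≤n
n≤n² (suc n) = ℕ.m≤m+n (suc n) _

-- A subgraph found by denseSubgraph contains a fixed proportion of the vertices.
order≤ : ∀ {d e s t M m} (H : Graph m) → 0ℚ < e → 1ℚ ≤ e * ι s → - d ≤ ι t →
  d * (ι m * (1ℚ + ι m)) + e * (ι M * ι M) ≤ ι (degreeSum H) →
  M ℕ.≤ suc (s ℕ.* suc (t ℕ.+ t)) ℕ.* m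
order≤ {d} {e} {s} {t} {M} {m} H 0<e 1≤es -d≤t dense = ℕ.≮⇒≥ λ κm<M →
  ℕ.<⇒≱ (ℕ.*-mono-< κm<M κm<M) (ℕ.≤-trans (ι-cancel-≤ M²≤) κm²≤)
  where
  -- As `t` bounds `- d` and the degree sum is at most `m²`, `eM² ≤ m² + t(m + m²) ≤ (1 + 2t)m²`.
  -- Multiplying by `s` gives `M² ≤ κm²`, and `κ ≤ (κ + 1)²` replaces a square root.
  κ = s ℕ.* suc (t ℕ.+ t)
  κm²≤ : κ ℕ.* (m ℕ.* m) ℕ.≤ (suc κ ℕ.* m) ℕ.* (suc κ ℕ.* m)
  κm²≤ = ℕ.≤-trans (ℕ.*-monoˡ-≤ (m ℕ.* m) (ℕ.≤-trans (ℕ.n≤1+n κ) (n≤n² (suc κ)))) (ℕ.≤-reflexive (eq (suc κ) m))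
    where
    eq : ∀ κ m → κ ℕ.* κ ℕ.* (m ℕ.* m) ≡ κ ℕ.* m ℕ.* (κ ℕ.* m)
    eq = ℕ-solver.solve-∀
  bound : ∀ m M s t D → 0ℚ ≤ m → 0ℚ ≤ M → m ≤ m * m → 0ℚ ≤ s → 0ℚ ≤ t → 1ℚ ≤ e * s → - d ≤ t → D ≤ m * m →
    d * (m * (1ℚ + m)) + e * (M * M) ≤ D → M * M ≤ s * (1ℚ + (t + t)) * (m * m)
  bound m M s t D 0≤m 0≤M m≤m² 0≤s 0≤t 1≤es -d≤t D≤ dense = ≤-fromDiff
    (0≤+ (0≤* (0≤y-x 1≤es) (0≤* 0≤M 0≤M)) (0≤* 0≤s (0≤+ (0≤+ (0≤y-x D≤) (0≤y-x dense))
      (0≤+ (0≤* (0≤y-x -d≤t) (0≤+ 0≤m (0≤* 0≤m 0≤m))) (0≤* 0≤t (0≤y-x m≤m²))))))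
    (eq d e m M s t D)
    where
    eq : ∀ d e m M s t D → s * (1ℚ + (t + t)) * (m * m) ≡ M * M +
      ((e * s - 1ℚ) * (M * M) + s * (m * m - D + (D - (d * (m * (1ℚ + m)) + e * (M * M))) +
        ((t - - d) * (m + m * m) + t * (m * m - m))))
    eq = solve 7 (λ d e m M s t D → s :* (:1 :+ (t :+ t)) :* (m :* m) := M :* M :+
      ((e :* s :- :1) :* (M :* M) :+ s :* (m :* m :- D :+ (D :- (d :* (m :* (:1 :+ m)) :+ e :* (M :* M))) :+
        ((t :- :- d) :* (m :+ m :* m) :+ t :* (m :* m :- m))))) refl
  M²≤ : ι (M ℕ.* M) ≤ ι (κ ℕ.* (m ℕ.* m))
  M²≤ = subst₂ _≤_ (sym (ι-* M M)) eq
    (bound (ι m) (ι M) (ι s) (ι t) (ι (degreeSum H)) (0≤ι m) (0≤ι M)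
      (subst (ι m ≤_) (ι-* m m) (ι-mono (n≤n² m))) (0≤ι s) (0≤ι t) 1≤es -d≤t
      (subst (ι (degreeSum H) ≤_) (ι-* m m) (ι-mono (degreeSum≤n² H))) dense)
    where
    eq : ι s * (1ℚ + (ι t + ι t)) * (ι m * ι m) ≡ ι (κ ℕ.* (m ℕ.* m))
    eq = sym (trans (ι-* κ (m ℕ.* m)) (cong₂ _*_
      (trans (ι-* s (suc (t ℕ.+ t))) (cong (ι s *_) (trans (ι-suc (t ℕ.+ t)) (cong (1ℚ +_) (ι-+ t t)))))
      (ι-* m m)))

-- The witness is the smaller of `x` and `y ÷₀ ι k`.
smallMultiple : ∀ {x y} k → 0ℚ < x → 0ℚ < y → 1 ℕ.≤ k → ∃[ a ] 0ℚ < a × a ≤ x × ι k * a ≤ y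
smallMultiple {x} {y} k 0<x 0<y 1≤k with ℚ.≤-total x (y ÷₀ ι k)
... | inj₁ x≤ = x , 0<x , ℚ.≤-refl , ℚ.≤-trans
  (ℚ.*-monoˡ-≤-nonNeg (ι k) ⦃ nonNegative (0≤ι k) ⦄ x≤) (ℚ.≤-reflexive (trans (ℚ.*-comm (ι k) _) (÷₀-* y (0<ι 1≤k))))
... | inj₂ ≤x = y ÷₀ ι k , 0<y/k , ≤x , ℚ.≤-reflexive (trans (ℚ.*-comm (ι k) _) (÷₀-* y (0<ι 1≤k)))
  where
  0<y/k : 0ℚ < y ÷₀ ι k
  0<y/k = ℚ.*-cancelʳ-<-nonNeg (ι k) ⦃ nonNegative (0≤ι k) ⦄
    (subst₂ _<_ (sym (ℚ.*-zeroˡ (ι k))) (sym (÷₀-* y (0<ι 1≤k))) 0<y)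

-- The order is `suc m` because later steps divide by it. `B` is only an upper bound since it is
-- inherited from the graph before deletions.
RamseyTuránWitness : ℕ → ℚ → ℚ → ℚ → Set₁
RamseyTuránWitness r ρ ε β = ∃[ m ] Σ[ H ∈ Graph (suc m) ] CliqueFree H r ×
  (∃[ B ] IndependenceAtMost H B × ι B ≤ ι (suc m) * β) ×
  (∀ v → (ρ - ε) * ι (suc m) ≤ ι (deg H v))

denseCliqueFree : ∀ {r ρ ε β} → IsRTDensity (K r) ρ → 0ℚ < ε → 0ℚ < β → RamseyTuránWitness r ρ ε β
denseCliqueFree {r} {ρ} {ε} {β} density 0<ε 0<β =
  -- Here `e = ε/8`: the two approximations of `ρ` lose `4e`, and the lower order terms another
  -- `4e`.
  let 4e , 0<4e , 4e+4e≡ε = halve 0<ε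
      2e , 0<2e , 2e+2e≡4e = halve 0<4e
      e , 0<e , e+e≡2e = halve 0<2e
      d≡ = cong (λ x → ρ - x) (trans (cong (λ x → x + x) (trans (cong (λ x → x + x) e+e≡2e) 2e+2e≡4e)) 4e+4e≡ε)
      s , 1≤es = archimedean-* 0<e 1ℚ
      t , -d≤t = archimedean (- (ρ - ε))
      M₁ , ρ≤ = archimedean-* 0<e ρ
      α₀ , 0<α₀ , limits = density e 0<e
      h , 0<h , h+h≡α₀ = halve 0<α₀
      -- The subgraph keeps at least `1/κ` of the `M` vertices, `κ` being the factor of `a` here, so
      -- an independence number of at most `aM` is at most `βm`. The bound by `h = α₀/2` keeps `a`
      -- strictly below `α₀`.
      a , 0<a , a≤h , κa≤β = smallMultiple (suc (s ℕ.* suc (t ℕ.+ t))) 0<h 0<β (s≤s z≤n)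
      ℓ , limit , ℓ≈ρ = limits (fromℚ a)
         (a , 0<a , 0 , λ _ _ → ℚ.≤-reflexive (ℚ.+-identityˡ a))
         (h , 0<h , 0 , λ _ _ → subst (a + h ≤_) h+h≡α₀ (ℚ.+-monoˡ-≤ h a≤h))
      N , graphs = limit e 0<e
      -- The 2 makes the binomial coefficient positive, `N` brings the density close to its limit,
      -- and `M₁` pays for the lower order terms.
      M = 2 ℕ.+ (N ℕ.+ M₁)
      k , isRT , k≈ℓ = graphs M (ℕ.≤-trans (ℕ.m≤m+n N M₁) (ℕ.m≤n+m (N ℕ.+ M₁) 2))
  in fromIsRT {s = s} {t} {ℓ = ℓ} M 0<e (s≤s (s≤s z≤n)) d≡ 1≤es -d≤t ρ≤ (ℕ.≤-trans (ℕ.m≤n+m M₁ N) (ℕ.m≤n+m (N ℕ.+ M₁) 2))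
       0<a κa≤β isRT k≈ℓ ℓ≈ρ
  where
  witness : ∀ {e s t a} M (G : Graph M) → 0ℚ < e → 1ℚ ≤ e * ι s → - (ρ - ε) ≤ ι t → 1 ℕ.≤ M →
    0ℚ < a → ι (suc (s ℕ.* suc (t ℕ.+ t))) * a ≤ β → ι (independenceNumber G) ≤ ι M * a →
    (∃[ m ] Σ[ H ∈ Graph m ] CliqueFree H r × IndependenceAtMost H (independenceNumber G) ×
      (∀ v → (ρ - ε) * ι m ≤ ι (deg H v)) ×
      (ρ - ε) * (ι m * (1ℚ + ι m)) + e * (ι M * ι M) ≤ ι (degreeSum H)) →
    RamseyTuránWitness r ρ ε β
  witness {s = s} {t} M G 0<e 1≤es -d≤t 1≤M 0<a κa≤β indep (zero , H , _ , _ , _ , dense) =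
    contradiction (subst (1 ℕ.≤_) (ℕ.*-zeroʳ (s ℕ.* suc (t ℕ.+ t)))
      (ℕ.≤-trans 1≤M (order≤ {s = s} {t} H 0<e 1≤es -d≤t dense))) λ ()
  witness {s = s} {t} {a} M G 0<e 1≤es -d≤t 1≤M 0<a κa≤β indep (suc m , H , free , indepH , large , dense) =
    m , H , free , (independenceNumber G , indepH , small) , large
    where
    κ = suc (s ℕ.* suc (t ℕ.+ t))
    small : ι (independenceNumber G) ≤ ι (suc m) * β
    small = ℚ.≤-trans indep (ℚ.≤-trans
      (ℚ.*-monoʳ-≤-nonNeg a ⦃ nonNegative (ℚ.<⇒≤ 0<a) ⦄ (ι-mono (order≤ {s = s} {t} H 0<e 1≤es -d≤t dense)))
      (subst (_≤ ι (suc m) * β) (sym eq) (ℚ.*-monoˡ-≤-nonNeg (ι (suc m)) ⦃ nonNegative (0≤ι (suc m)) ⦄ κa≤β)))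
      where
      eq : ι (κ ℕ.* suc m) * a ≡ ι (suc m) * (ι κ * a)
      eq = trans (cong (_* a) (trans (cong ι (ℕ.*-comm κ (suc m))) (ι-* (suc m) κ))) (ℚ.*-assoc (ι (suc m)) (ι κ) a)

  fromIsRT : ∀ {e s t a M₁ ℓ k} M → 0ℚ < e → 2 ℕ.≤ M → ρ - (e + e + (e + e) + (e + e + (e + e))) ≡ ρ - ε →
    1ℚ ≤ e * ι s → - (ρ - ε) ≤ ι t → ρ ≤ e * ι M₁ → M₁ ℕ.≤ M →
    0ℚ < a → ι (suc (s ℕ.* suc (t ℕ.+ t))) * a ≤ β → IsRT M (K r) (fromℕ M · fromℚ a) k →
    Within e (fromℚ (fromℕ k ÷₀ fromℕ (M C 2))) ℓ → Within e ℓ (fromℚ ρ) → RamseyTuránWitness r ρ ε β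
  fromIsRT {e} {s} {t} {a} {ℓ = ℓ} {k} M 0<e 2≤M d≡ 1≤es -d≤t ρ≤ M₁≤M 0<a κa≤β isRT k≈ℓ ℓ≈ρ =
    let G , free , indep , edges = ramseyTuránGraph {H = K r} {e} {a} {ρ} {ℓ} {k} M 0<e 2≤M isRT k≈ℓ ℓ≈ρ in
    witness {s = s} {t} M G 0<e 1≤es -d≤t (ℕ.≤-trans (ℕ.n≤1+n 1) 2≤M) 0<a κa≤β indep
      (denseSubgraph (ρ - ε) (e * (ι M * ι M)) M G (free⇒cliqueFree G free) (independenceAtMost G)
        (subst (λ d → d * (ι M * (1ℚ + ι M)) + e * (ι M * ι M) ≤ ι (degreeSum G)) d≡
          (ramseyTurán⇒dense M G 0<e ρ≤ M₁≤M edges)))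

-- This makes the divisor in `degreeRatio ρ` at least 1 and `1 − ρ` a nonnegative factor in the
-- degree estimates.
density≤1 : ∀ {r ρ} → IsRTDensity (K r) ρ → ρ ≤ 1ℚ
density≤1 {ρ = ρ} density = ≤-fromSlack λ ε 0<ε →
  let m , H , _ , _ , large = denseCliqueFree density 0<ε (ℚ.positive⁻¹ 1ℚ) in
  ≤-fromDiff (0≤y-x (ρ-ε≤1 ε m H large)) (eq ρ ε)
  where
  ρ-ε≤1 : ∀ ε m (H : Graph (suc m)) → (∀ v → (ρ - ε) * ι (suc m) ≤ ι (deg H v)) → ρ - ε ≤ 1ℚ
  ρ-ε≤1 ε m H large = ℚ.*-cancelʳ-≤-pos (ι (suc m)) ⦃ positive (0<ι (s≤s z≤n)) ⦄
    (ℚ.≤-trans (large zero) (ℚ.≤-trans (ι-mono (deg≤n H zero))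
      (ℚ.≤-reflexive (sym (ℚ.*-identityˡ (ι (suc m)))))))
  eq : ∀ ρ ε → 1ℚ + ε ≡ ρ + (1ℚ - (ρ - ε))
  eq = solve 2 (λ ρ ε → :1 :+ ε := ρ :+ (:1 :- (ρ :- ε))) refl

-- The construction

-- The cliques have `suc b₁` and `suc b₂` vertices, so both sides of the cut are inhabited.
module CutConstruction (H : Graph m) (q b₁ b₂ : ℕ) where
  A : Graph (m ℕ.* q)
  A = blowup q H

  cliques : Graph (suc b₁ ℕ.+ suc b₂)
  cliques = glue false (K (suc b₁)) (K (suc b₂))

  order : ℕ
  order = m ℕ.* q ℕ.+ (suc b₁ ℕ.+ suc b₂)

  G : Graph order
  G = glue true A cliques

  open Graph G

  independence : ∀ {B} → IndependenceAtMost H B → IndependenceAtMost G (q ℕ.* B ℕ.+ 2)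
  independence indep = glue-independence true A cliques (blowup-independence q H indep)
    (glue-independence false (K (suc b₁)) (K (suc b₂)) K-independence K-independence)

  deg-A : ∀ v → deg G (v ↑ˡ (suc b₁ ℕ.+ suc b₂)) ≡ q ℕ.* deg H (quotient q v) ℕ.+ (suc b₁ ℕ.+ suc b₂)
  deg-A v = trans (deg-glueˡ true A cliques v) (cong₂ ℕ._+_ (deg-blowup q H v) (ℕ.*-identityʳ _))

  deg-cliques : ∀ w {d} → deg cliques w ≡ d → deg G (m ℕ.* q ↑ʳ w) ≡ m ℕ.* q ℕ.+ d
  deg-cliques w deg≡ = trans (deg-glueʳ true A cliques w) (cong₂ ℕ._+_ (ℕ.*-identityʳ _) deg≡)

  deg-clique₁ : ∀ x → deg cliques (x ↑ˡ suc b₂) ≡ b₁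
  deg-clique₁ x = trans (deg-glueˡ false (K (suc b₁)) (K (suc b₂)) x)
    (trans (cong₂ ℕ._+_ (deg-K x) (ℕ.*-zeroʳ (suc b₂))) (ℕ.+-identityʳ b₁))

  deg-clique₂ : ∀ y → deg cliques (suc b₁ ↑ʳ y) ≡ b₂
  deg-clique₂ y = trans (deg-glueʳ false (K (suc b₁)) (K (suc b₂)) y)
    (cong₂ ℕ._+_ (ℕ.*-zeroʳ (suc b₁)) (deg-K y))

  deg-all : (P : ℕ → Set) → (∀ v → P (q ℕ.* deg H v ℕ.+ (suc b₁ ℕ.+ suc b₂))) →
    P (m ℕ.* q ℕ.+ b₁) → P (m ℕ.* q ℕ.+ b₂) → ∀ u → P (deg G u)
  deg-all P PA P₁ P₂ = ↑-elim (m ℕ.* q) (λ u → P (deg G u))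
    (λ v → subst P (sym (deg-A v)) (PA (quotient q v)))
    (↑-elim (suc b₁) (λ w → P (deg G (m ℕ.* q ↑ʳ w)))
      (λ x → subst P (sym (deg-cliques (x ↑ˡ suc b₂) (deg-clique₁ x))) P₁)
      (λ y → subst P (sym (deg-cliques (suc b₁ ↑ʳ y) (deg-clique₂ y))) P₂))

  side : Fin (suc b₁) ⊎ Fin (suc b₂) → Maybe Bool
  side = [ const (just true) , const (just false) ]′

  label : Fin order → Maybe Bool
  label = [ const nothing , side ∘ splitAt (suc b₁) ]′ ∘ splitAt (m ℕ.* q)

  label-↑ʳ : ∀ w → label (m ℕ.* q ↑ʳ w) ≡ side (splitAt (suc b₁) w)
  label-↑ʳ w = cong [ const nothing , side ∘ splitAt (suc b₁) ]′ (splitAt-↑ʳ (m ℕ.* q) (suc b₁ ℕ.+ suc b₂) w)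

  separated : ∀ {u v b c} → label u ≡ just b → label v ≡ just c → u ~ v → b ≡ c
  separated {u} {v} lu lv u~v with splitAt (m ℕ.* q) u | splitAt (m ℕ.* q) v
  ... | inj₂ w | inj₂ x with splitAt (suc b₁) w | splitAt (suc b₁) x
  separated refl refl _ | inj₂ w | inj₂ x | inj₁ _ | inj₁ _ = refl
  separated refl refl _ | inj₂ w | inj₂ x | inj₂ _ | inj₂ _ = refl
  separated refl refl () | inj₂ w | inj₂ x | inj₁ _ | inj₂ _
  separated refl refl () | inj₂ w | inj₂ x | inj₂ _ | inj₁ _

  cut-cliqueFree : ∀ {r} → CliqueFree H r → (g : Fin r → Fin order) → (∀ i → label (g i) ≡ nothing) →
    ¬ (∀ i j → i ≢ j → g i ~ g j)
  cut-cliqueFree free g inCut clique = pullback-cliqueFree (quotient q) H free (λ i → proj₁ (preimage i)) λ i j i≢j →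
    subst id (trans (cong₂ _~_ (sym (proj₂ (preimage i))) (sym (proj₂ (preimage j)))) (glue-↑ˡ true A cliques)) (clique i j i≢j)
    where
    find : ∀ u → label u ≡ nothing → ∃[ v ] v ↑ˡ (suc b₁ ℕ.+ suc b₂) ≡ u
    find u lu with splitAt (m ℕ.* q) u in eq
    ... | inj₁ v = v , splitAt⁻¹-↑ˡ eq
    ... | inj₂ w with splitAt (suc b₁) w
    find u () | inj₂ w | inj₁ _
    find u () | inj₂ w | inj₂ _
    preimage : ∀ i → ∃[ v ] v ↑ˡ (suc b₁ ℕ.+ suc b₂) ≡ g i
    preimage i = find (g i) (inCut i)

  ¬hamiltonCyclePower : ∀ {r} → CliqueFree H r → ¬ HasHamiltonCyclePower r G
  ¬hamiltonCyclePower free = cliqueFreeCut⇒¬hamiltonCyclePower G label separated (cut-cliqueFree free)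
    (m ℕ.* q ↑ʳ (zero ↑ˡ suc b₂) , trans (label-↑ʳ (zero ↑ˡ suc b₂)) (cong side (splitAt-↑ˡ (suc b₁) zero (suc b₂))))
    (m ℕ.* q ↑ʳ (suc b₁ ↑ʳ zero) , trans (label-↑ʳ (suc b₁ ↑ʳ zero)) (cong side (splitAt-↑ʳ (suc b₁) (suc b₂) zero)))

-- Degree estimates for the construction

minDegree-all : (G : Graph n) (P : ℕ → Set) → P n → (∀ u → P (deg G u)) → P (minDegree G)
minDegree-all {n} G P Pn h = argmin-all id {n} {List.map (degree G) (allFin n)} {P} Pn
  (map⁺ (tabulate⁺ λ u → subst P (sym (degree≡deg G u)) (h u)))

⌈n/2⌉≤1+⌊n/2⌋ : ∀ n → ⌈ n /2⌉ ℕ.≤ suc ⌊ n /2⌋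
⌈n/2⌉≤1+⌊n/2⌋ zero          = z≤n
⌈n/2⌉≤1+⌊n/2⌋ (suc zero)    = s≤s z≤n
⌈n/2⌉≤1+⌊n/2⌋ (suc (suc n)) = s≤s (⌈n/2⌉≤1+⌊n/2⌋ n)

-- The vertex `u₀` takes care of the default value `n` in `minDegree`: `x ≤ deg u₀ ≤ n`.
minDegree≥ : ∀ {x} (G : Graph n) → Fin n → (∀ u → x ≤ ι (deg G u)) → x ≤ ι (minDegree G)
minDegree≥ {x = x} G u₀ h = minDegree-all G (λ k → x ≤ ι k) (ℚ.≤-trans (h u₀) (ι-mono (deg≤n G u₀))) h

module DegreeBounds {ρ : ℚ} (ρ≤1 : ρ ≤ 1ℚ) where
  σ : ℚ
  σ = fromℕ 3 - fromℕ 2 * ρ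

  σ≡ : ∀ ρ → fromℕ 3 - fromℕ 2 * ρ ≡ 1ℚ + (1ℚ - ρ + (1ℚ - ρ))
  σ≡ = solve 1 (λ ρ → con (ℤ.+ 3) :- con (ℤ.+ 2) :* ρ := :1 :+ (:1 :- ρ :+ (:1 :- ρ))) refl

  1≤σ : 1ℚ ≤ σ
  1≤σ = ≤-fromDiff (0≤+ (0≤y-x ρ≤1) (0≤y-x ρ≤1)) (σ≡ ρ)

  0<σ : 0ℚ < σ
  0<σ = ℚ.<-≤-trans (ℚ.positive⁻¹ 1ℚ) 1≤σ

  0≤σ : 0ℚ ≤ σ
  0≤σ = ℚ.<⇒≤ 0<σ

  degreeRatio*σ : degreeRatio ρ * σ ≡ fromℕ 2 - ρ
  degreeRatio*σ = ÷₀-* (fromℕ 2 - ρ) 0<σ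

  -- Both degree bounds are checked after multiplication by `σ`, which clears the denominator of
  -- `degreeRatio ρ`.
  scaled : ∀ n μ → (degreeRatio ρ * n - n * μ) * σ ≡ (fromℕ 2 - ρ) * n - n * μ * σ
  scaled n μ = trans (eq (degreeRatio ρ) n μ σ) (cong (λ x → x * n - n * μ * σ) degreeRatio*σ)
    where
    eq : ∀ d n μ σ → (d * n - n * μ) * σ ≡ d * σ * n - n * μ * σ
    eq = solve 4 (λ d n μ σ → (d :* n :- n :* μ) :* σ := d :* σ :* n :- n :* μ :* σ) refl

  -- A vertex of the blow-up misses at most `(1 − ρ + μ)mq` vertices, and `mq` is at most `1/σ` of
  -- the order `mq + b`. Now `1 − (1 − ρ)/σ = (2 − ρ)/σ`.
  blowup-degree : ∀ {μ m q g b} → 0ℚ ≤ μ → 0ℚ ≤ q → 0ℚ ≤ b → (ρ - μ) * m ≤ g → σ * m * q ≤ m * q + b →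
    degreeRatio ρ * (m * q + b) - (m * q + b) * μ ≤ q * g + b
  blowup-degree {μ} {m} {q} {g} {b} 0≤μ 0≤q 0≤b g≥ q≤ = ℚ.*-cancelʳ-≤-pos σ ⦃ positive 0<σ ⦄
    (≤-fromDiff (0≤+ (0≤* (0≤* 0≤σ 0≤q) (0≤y-x g≥)) (0≤+ (0≤* (0≤y-x ρ≤1) (0≤y-x q≤)) (0≤* (0≤* 0≤μ 0≤σ) 0≤b)))
      (trans (eq ρ μ m q g b) (cong (λ x → x + (σ * q * (g - (ρ - μ) * m) + ((1ℚ - ρ) * (m * q + b - σ * m * q) + μ * σ * b)))
        (sym (scaled (m * q + b) μ)))))
    where
    eq : ∀ ρ μ m q g b → let σ = fromℕ 3 - fromℕ 2 * ρ in
      (q * g + b) * σ ≡ (fromℕ 2 - ρ) * (m * q + b) - (m * q + b) * μ * σ +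
        (σ * q * (g - (ρ - μ) * m) + ((1ℚ - ρ) * (m * q + b - σ * m * q) + μ * σ * b))
    eq = solve 6 (λ ρ μ m q g b → let σ = con (ℤ.+ 3) :- con (ℤ.+ 2) :* ρ in
      (q :* g :+ b) :* σ := (con (ℤ.+ 2) :- ρ) :* (m :* q :+ b) :- (m :* q :+ b) :* μ :* σ :+
        (σ :* q :* (g :- (ρ :- μ) :* m) :+ ((:1 :- ρ) :* (m :* q :+ b :- σ :* m :* q) :+ μ :* σ :* b))) refl

  -- The degree is about half of `n + mq`, where `mq` falls short of `n/σ` by at most `m + 2`. Now
  -- `(1 + 1/σ)/2 = (2 − ρ)/σ`, and `large` pays for all rounding.
  clique-degree : ∀ {μ m q h y n} → 0ℚ ≤ m → y ≤ 1ℚ + (h + h) → m * q + y ≤ σ * m * (1ℚ + q) →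
    n ≡ 1ℚ + (1ℚ + (m * q + y)) → 1ℚ + (1ℚ + (1ℚ + m)) ≤ μ * n →
    degreeRatio ρ * n - n * μ ≤ m * q + h
  clique-degree {μ} {m} {q} {h} {y} {n} 0≤m y≤ q≥ refl large = ℚ.*-cancelʳ-≤-pos σ ⦃ positive 0<σ ⦄
    (≤-fromDouble (≤-fromDiff (0≤+ (0≤* 0≤σ (0≤y-x y≤)) (0≤+ (0≤y-x q≥)
        (0≤+ (0≤* 0≤σ (0≤+ (0≤y-x large) (0≤y-x large)))
          (0≤+ (0≤* 0≤σ 0≤m) (0≤+ 0≤σ (0≤+ (0≤y-x 1≤σ) (0≤y-x 1≤σ)))))))
      (trans (eq ρ μ m q h y) (cong (λ z → z + z + (σ * (1ℚ + (h + h) - y) + (σ * m * (1ℚ + q) - (m * q + y) +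
          (σ * (μ * n - (1ℚ + (1ℚ + (1ℚ + m))) + (μ * n - (1ℚ + (1ℚ + (1ℚ + m))))) +
            (σ * m + (σ + (σ - 1ℚ + (σ - 1ℚ)))))))) (sym (scaled n μ))))))
    where
    ≤-fromDouble : ∀ {a b} → a + a ≤ b + b → a ≤ b
    ≤-fromDouble {a} {b} h with a ℚ.≤? b
    ... | yes p = p
    ... | no ¬p = contradiction (ℚ.<-≤-trans (ℚ.+-mono-< (ℚ.≰⇒> ¬p) (ℚ.≰⇒> ¬p)) h) (ℚ.<-irrefl refl)
    eq : ∀ ρ μ m q h y → let σ = fromℕ 3 - fromℕ 2 * ρ; n = 1ℚ + (1ℚ + (m * q + y)); z = (fromℕ 2 - ρ) * n - n * μ * σ in
      (m * q + h) * σ + (m * q + h) * σ ≡ z + z +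
        (σ * (1ℚ + (h + h) - y) + (σ * m * (1ℚ + q) - (m * q + y) +
          (σ * (μ * n - (1ℚ + (1ℚ + (1ℚ + m))) + (μ * n - (1ℚ + (1ℚ + (1ℚ + m))))) +
            (σ * m + (σ + (σ - 1ℚ + (σ - 1ℚ)))))))
    eq = solve 6 (λ ρ μ m q h y → let σ = con (ℤ.+ 3) :- con (ℤ.+ 2) :* ρ
                                      n = :1 :+ (:1 :+ (m :* q :+ y))
                                      z = (con (ℤ.+ 2) :- ρ) :* n :- n :* μ :* σ in
      (m :* q :+ h) :* σ :+ (m :* q :+ h) :* σ := z :+ z :+
        (σ :* (:1 :+ (h :+ h) :- y) :+ (σ :* m :* (:1 :+ q) :- (m :* q :+ y) :+
          (σ :* (μ :* n :- (:1 :+ (:1 :+ (:1 :+ m))) :+ (μ :* n :- (:1 :+ (:1 :+ (:1 :+ m))))) :+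
            (σ :* m :+ (σ :+ (σ :- :1 :+ (σ :- :1)))))))) refl

CounterexampleTo : ℕ → ℚ → ℚ → ℚ → ℕ → Set₁
CounterexampleTo r ρ μ α n = Σ[ G ∈ Graph n ]
  (degreeRatio ρ * ι n - ι n * μ ≤ ι (minDegree G)) × (ι (independenceNumber G) ≤ ι n * α) × ¬ HasHamiltonCyclePower r G

-- The `y + 2` vertices outside the blow-up are halved into two cliques. The bounds on `q` put `mq`
-- within `m` of `(mq + y)/σ`. One `β` pays for independent vertices in the blow-up, the other for
-- the two from the cliques.
cutGraph : ∀ {r ρ μ β m B} (H : Graph m) q y → ρ ≤ 1ℚ → 0ℚ ≤ μ → 0ℚ ≤ β →
  CliqueFree H r → IndependenceAtMost H B → ι B ≤ ι m * β → (∀ v → (ρ - μ) * ι m ≤ ι (deg H v)) →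
  (fromℕ 3 - fromℕ 2 * ρ) * ι m * ι q ≤ ι (m ℕ.* q ℕ.+ y) →
  ι (m ℕ.* q ℕ.+ y) ≤ (fromℕ 3 - fromℕ 2 * ρ) * ι m * ι (suc q) →
  ι (3 ℕ.+ m) ≤ μ * ι (2 ℕ.+ (m ℕ.* q ℕ.+ y)) → ι 2 ≤ β * ι (2 ℕ.+ (m ℕ.* q ℕ.+ y)) →
  CounterexampleTo r ρ μ (β + β) (2 ℕ.+ (m ℕ.* q ℕ.+ y))
cutGraph {r} {ρ} {μ} {β} {m} {B} H q y ρ≤1 0≤μ 0≤β free indep B≤ large q≤ q≥ μ-large β-large =
  subst (CounterexampleTo r ρ μ (β + β)) order≡
    (G , minDegree≥ G (m ℕ.* q ↑ʳ zero) (deg-all (λ d → degreeRatio ρ * ι order - ι order * μ ≤ ι d) atA atClique₁ atClique₂) ,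
     ℚ.≤-trans (ι-mono (independenceNumber≤ G (independence indep))) independence≤ ,
     ¬hamiltonCyclePower free)
  where
  h₁ = ⌊ y /2⌋
  h₂ = ⌈ y /2⌉
  open CutConstruction H q h₁ h₂
  open DegreeBounds ρ≤1

  order≡ : order ≡ 2 ℕ.+ (m ℕ.* q ℕ.+ y)
  order≡ = trans (eq (m ℕ.* q) h₁ h₂) (cong (λ y → 2 ℕ.+ (m ℕ.* q ℕ.+ y)) (ℕ.⌊n/2⌋+⌈n/2⌉≡n y))
    where
    eq : ∀ a h₁ h₂ → a ℕ.+ (suc h₁ ℕ.+ suc h₂) ≡ 2 ℕ.+ (a ℕ.+ (h₁ ℕ.+ h₂))
    eq = ℕ-solver.solve-∀

  mq+≡ : ∀ b → ι m * ι q + ι b ≡ ι (m ℕ.* q ℕ.+ b)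
  mq+≡ b = sym (trans (ι-+ (m ℕ.* q) b) (cong (_+ ι b) (ι-* m q)))

  atA : ∀ v → degreeRatio ρ * ι order - ι order * μ ≤ ι (q ℕ.* deg H v ℕ.+ (suc h₁ ℕ.+ suc h₂))
  atA v = subst₂ (λ n d → degreeRatio ρ * n - n * μ ≤ d) (mq+≡ (suc h₁ ℕ.+ suc h₂))
    (sym (trans (ι-+ (q ℕ.* deg H v) (suc h₁ ℕ.+ suc h₂)) (cong (_+ ι (suc h₁ ℕ.+ suc h₂)) (ι-* q (deg H v)))))
    (blowup-degree {μ} {ι m} {ι q} 0≤μ (0≤ι q) (0≤ι (suc h₁ ℕ.+ suc h₂)) (large v)
      (ℚ.≤-trans q≤ (subst (ι (m ℕ.* q ℕ.+ y) ≤_) (sym (mq+≡ (suc h₁ ℕ.+ suc h₂)))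
        (ι-mono (subst (m ℕ.* q ℕ.+ y ℕ.≤_) (sym order≡) (ℕ.m≤n+m (m ℕ.* q ℕ.+ y) 2))))))

  atClique₁ : degreeRatio ρ * ι order - ι order * μ ≤ ι (m ℕ.* q ℕ.+ h₁)
  atClique₁ = subst (degreeRatio ρ * ι order - ι order * μ ≤_) (mq+≡ h₁)
    (clique-degree {μ} {ι m} {ι q} {ι h₁} {ι y} (0≤ι m)
      (subst (ι y ≤_) (trans (ι-suc (h₁ ℕ.+ h₁)) (cong (1ℚ +_) (ι-+ h₁ h₁))) (ι-mono y≤))
      (subst₂ (λ a b → a ≤ (fromℕ 3 - fromℕ 2 * ρ) * ι m * b) (sym (mq+≡ y)) (ι-suc q) q≥)
      (trans (cong ι order≡) (trans (ι-suc (suc (m ℕ.* q ℕ.+ y))) (cong (1ℚ +_) (trans (ι-suc (m ℕ.* q ℕ.+ y)) (cong (1ℚ +_) (sym (mq+≡ y)))))))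
      (subst₂ (λ a n → a ≤ μ * ι n) (trans (ι-suc (2 ℕ.+ m)) (cong (1ℚ +_) (trans (ι-suc (suc m)) (cong (1ℚ +_) (ι-suc m)))))
        (sym order≡) μ-large))
    where
    y≤ : y ℕ.≤ suc (h₁ ℕ.+ h₁)
    y≤ = subst (ℕ._≤ suc (h₁ ℕ.+ h₁)) (ℕ.⌊n/2⌋+⌈n/2⌉≡n y)
      (ℕ.≤-trans (ℕ.+-monoʳ-≤ h₁ (⌈n/2⌉≤1+⌊n/2⌋ y)) (ℕ.≤-reflexive (ℕ.+-suc h₁ h₁)))

  atClique₂ : degreeRatio ρ * ι order - ι order * μ ≤ ι (m ℕ.* q ℕ.+ h₂)
  atClique₂ = ℚ.≤-trans atClique₁ (ι-mono (ℕ.+-monoʳ-≤ (m ℕ.* q) (ℕ.⌊n/2⌋≤⌈n/2⌉ y)))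

  independence≤ : ι (q ℕ.* B ℕ.+ 2) ≤ ι order * (β + β)
  independence≤ = subst₂ _≤_ (sym (trans (ι-+ (q ℕ.* B) 2) (cong (_+ ι 2) (ι-* q B)))) (sym (ℚ.*-distribˡ-+ (ι order) β β))
    (ℚ.+-mono-≤
      (ℚ.≤-trans (ℚ.*-monoˡ-≤-nonNeg (ι q) ⦃ nonNegative (0≤ι q) ⦄ B≤)
        (subst (_≤ ι order * β) (trans (cong (_* β) (trans (ι-* m q) (ℚ.*-comm (ι m) (ι q)))) (ℚ.*-assoc (ι q) (ι m) β))
          (ℚ.*-monoʳ-≤-nonNeg β ⦃ nonNegative 0≤β ⦄ (ι-mono (ℕ.m≤m+n (m ℕ.* q) (suc h₁ ℕ.+ suc h₂))))))
      (subst (ι 2 ≤_) (trans (cong (λ n → β * ι n) (sym order≡)) (ℚ.*-comm β (ι order))) β-large))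

rationalCounterexample : ∀ {r ρ μ α} → IsRTDensity (K r) ρ → 0ℚ < μ → 0ℚ < α →
  ∃[ n₀ ] ∀ n → n₀ ℕ.≤ n → CounterexampleTo r ρ μ α n
rationalCounterexample {r} {ρ} {μ} {α} density 0<μ 0<α =
  let β , 0<β , β+β≡α = halve 0<α
      m , H , free , (B , indep , B≤) , large = denseCliqueFree density 0<μ 0<β
      -- Thresholds for the order in `cutGraph`; `H` has `suc m` vertices, so `3 + suc m` becomes
      -- `4 + m`.
      s₁ , μ-large = archimedean-* 0<μ (ι (4 ℕ.+ m))
      s₂ , β-large = archimedean-* 0<β (ι 2)
  in 2 ℕ.+ (s₁ ℕ.+ s₂) , λ n n₀≤n → subst (λ α → CounterexampleTo r ρ μ α n) β+β≡α
       (construct {β} {m} {B} {s₁} {s₂} 0<β H free indep B≤ large μ-large β-large n n₀≤n)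
  where
  ρ≤1 = density≤1 density
  open DegreeBounds ρ≤1 using (σ; 1≤σ)
  construct : ∀ {β m B s₁ s₂} → 0ℚ < β → (H : Graph (suc m)) → CliqueFree H r → IndependenceAtMost H B →
    ι B ≤ ι (suc m) * β → (∀ v → (ρ - μ) * ι (suc m) ≤ ι (deg H v)) →
    ι (4 ℕ.+ m) ≤ μ * ι s₁ → ι 2 ≤ β * ι s₂ →
    ∀ n → 2 ℕ.+ (s₁ ℕ.+ s₂) ℕ.≤ n → CounterexampleTo r ρ μ (β + β) n
  construct {β} {m} {B} {s₁} {s₂} 0<β H free indep B≤ large μ-large β-large (suc (suc x)) (s≤s (s≤s s≤x)) =
    -- With `x = n − 2`, `q` is the rounded quotient of `x` by `σ(m + 1)`. As `σ` is at least 1,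
    -- `(m + 1)q` does not exceed `x` and the truncated subtraction below is exact.
    let q , q≤ , q≥ = floor-÷ 1≤c x
        mq≤x = ι-cancel-≤ (ℚ.≤-trans (mq≤ q) q≤)
        x≡ = sym (ℕ.m+[n∸m]≡n mq≤x)
        n≡ = cong (2 ℕ.+_) x≡
    in subst (CounterexampleTo r ρ μ (β + β)) (sym n≡)
         (cutGraph H q (x ℕ.∸ suc m ℕ.* q) ρ≤1 (ℚ.<⇒≤ 0<μ) (ℚ.<⇒≤ 0<β) free indep B≤ large
           (subst (λ x → σ * ι (suc m) * ι q ≤ ι x) x≡ q≤) (subst (λ x → ι x ≤ σ * ι (suc m) * ι (suc q)) x≡ q≥)
           (subst (λ n → ι (4 ℕ.+ m) ≤ μ * ι n) n≡ (grow 0<μ (ℕ.≤-trans (ℕ.m≤m+n s₁ s₂) s≤) μ-large))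
           (subst (λ n → ι 2 ≤ β * ι n) n≡ (grow 0<β (ℕ.≤-trans (ℕ.m≤n+m s₂ s₁) s≤) β-large)))
    where
    s≤ : s₁ ℕ.+ s₂ ℕ.≤ suc (suc x)
    s≤ = ℕ.≤-trans s≤x (ℕ.m≤n+m x 2)
    grow : ∀ {y e s n} → 0ℚ < e → s ℕ.≤ n → y ≤ e * ι s → y ≤ e * ι n
    grow {e = e} 0<e s≤n y≤ = ℚ.≤-trans y≤ (ℚ.*-monoˡ-≤-nonNeg e ⦃ nonNegative (ℚ.<⇒≤ 0<e) ⦄ (ι-mono s≤n))
    m≤σm : ι (suc m) ≤ σ * ι (suc m)
    m≤σm = subst (_≤ σ * ι (suc m)) (ℚ.*-identityˡ (ι (suc m))) (ℚ.*-monoʳ-≤-nonNeg (ι (suc m)) ⦃ nonNegative (0≤ι (suc m)) ⦄ 1≤σ)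
    1≤c : 1ℚ ≤ σ * ι (suc m)
    1≤c = ℚ.≤-trans (≤-fromDiff (0≤ι m) (ι-suc m)) m≤σm
    mq≤ : ∀ q → ι (suc m ℕ.* q) ≤ σ * ι (suc m) * ι q
    mq≤ q = subst (_≤ σ * ι (suc m) * ι q) (sym (ι-* (suc m) q)) (ℚ.*-monoʳ-≤-nonNeg (ι q) ⦃ nonNegative (0≤ι q) ⦄ m≤σm)

-- From rational to real parameters

-- Replacing `μ` and `α` by smaller positive rationals strengthens the conclusion, so the rational
-- case suffices.
positive-lowerBound : ∀ x → fromℚ 0ℚ <ᴿ x → ∃[ q ] 0ℚ < q × ∃[ N ] ∀ i → N ℕ.≤ i → q ≤ seq x i
positive-lowerBound x (ε , 0<ε , N , h) = ε , 0<ε , N , λ i N≤i → subst (_≤ seq x i) (ℚ.+-identityˡ ε) (h i N≤i)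

≤-addPositive : ∀ {x y ε} → 0ℚ < ε → x ≤ y → x ≤ y + ε
≤-addPositive {y = y} {ε} 0<ε x≤y = ℚ.≤-trans x≤y (≤-fromDiff (ℚ.<⇒≤ 0<ε) refl)

proposition1p4 : ∀ (μ α : ℝ) (r : ℕ) (ρ : ℚ) →
    fromℚ 0ℚ <ᴿ μ → fromℚ 0ℚ <ᴿ α → 3 ℕ.≤ r →
    IsRTDensity (K r) ρ →
    ∃[ n₀ ] ∀ (n : ℕ) → n₀ ℕ.≤ n →
    Σ[ G ∈ Graph n ]
    (fromℚ (degreeRatio ρ * fromℕ n) -ᴿ fromℕ n · μ ≤ᴿ fromℚ (fromℕ (minDegree G)))
    × (fromℚ (fromℕ (independenceNumber G)) ≤ᴿ fromℕ n · α)
    × ¬ HasHamiltonCyclePower r G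
proposition1p4 μ α r ρ 0<μ 0<α _ density =
  let μ₀ , 0<μ₀ , N , μ₀≤ = positive-lowerBound μ 0<μ
      α₀ , 0<α₀ , N′ , α₀≤ = positive-lowerBound α 0<α
      n₀ , counterexample = rationalCounterexample density 0<μ₀ 0<α₀
  in n₀ , λ n n₀≤n →
    let G , degree≥ , independence≤ , ¬hamilton = counterexample n n₀≤n in
    G ,
    (λ ε 0<ε → N , λ i N≤i → ≤-addPositive 0<ε (degree-bound n (minDegree G) degree≥ (μ₀≤ i N≤i))) ,
    (λ ε 0<ε → N′ , λ i N′≤i → ≤-addPositive 0<ε (independence-bound n (independenceNumber G) independence≤ (α₀≤ i N′≤i))) ,
    ¬hamilton
  where
  degree-bound : ∀ n d {μ₀ μᵢ} → degreeRatio ρ * ι n - ι n * μ₀ ≤ ι d → μ₀ ≤ μᵢ →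
    degreeRatio ρ * fromℕ n - fromℕ n * μᵢ ≤ fromℕ d
  degree-bound n d {μ₀} {μᵢ} h μ₀≤ = subst₂ (λ n d → degreeRatio ρ * n - n * μᵢ ≤ d) (ι≡fromℕ n) (ι≡fromℕ d)
    (ℚ.≤-trans (ℚ.+-monoʳ-≤ (degreeRatio ρ * ι n) (ℚ.neg-antimono-≤ (ℚ.*-monoˡ-≤-nonNeg (ι n) ⦃ nonNegative (0≤ι n) ⦄ μ₀≤))) h)
  independence-bound : ∀ n k {α₀ αᵢ} → ι k ≤ ι n * α₀ → α₀ ≤ αᵢ → fromℕ k ≤ fromℕ n * αᵢ
  independence-bound n k {α₀} {αᵢ} h α₀≤ = subst₂ (λ k n → k ≤ n * αᵢ) (ι≡fromℕ k) (ι≡fromℕ n)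
    (ℚ.≤-trans h (ℚ.*-monoˡ-≤-nonNeg (ι n) ⦃ nonNegative (0≤ι n) ⦄ α₀≤))
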